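{- Let $p$ be a prime and $m\geq 3$ an integer with $\gcd(p,m)=1$ and $\gcd(p-1,m)=1$. Let $\ell=\min\{e\geq 1:\gcd(p^e-1,m)>1\}$, $m'=\gcd(p^\ell-1,m)$ and $d'=(p^\ell-1)/m'$. Let $K=\mathbb{F}_{p^k}$ be a finite field containing all $m$th roots of unity and $d=(p^k-1)/m$. Then every integer $n\geq d'$ lies in $W_p(m')$ and every integer $n\geq d$ lies in $W_p(m)$, except in the following two special cases: (A) $d'=p-1$; (B) $p=2$, $d'=3$ and $m'=5$. In these special cases, every integer $n\geq d'+1$ lies in $W_p(m')$ and every integer $n\geq d+1$ lies in $W_p(m)$.
   Context: For a prime $p$ and a positive integer $m$, $W_p(m)$ denotes the set of integers $n\geq 0$ for which there exist $\alpha_1,\dots,\alpha_n\in\overline{\mathbb{F}}_p$ with $\alpha_i^m=1$ for all $i$ (repetitions allowed) and $\alpha_1+\cdots+\alpha_n=0$. -}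

module Defs where

open import Level using (Level; _⊔_) renaming (suc to lsuc)
open import Data.Nat using (ℕ; suc)
open import Data.Fin using (Fin)
import Data.Fin
import Data.Nat
open import Data.Product using (Σ; ∃; _×_)
open import Relation.Nullary using (¬_)
open import Algebra.Bundles using (CommutativeRing; Semiring)
import Algebra.Definitions.RawSemiring as RS

-- An algebraic closure of the prime field F_p, presented abstractly:
-- a field of characteristic p which is algebraically closed and
-- algebraic over its prime subfield (the image of ℕ → F, n ↦ n·1).
record AlgClosureFp (p : ℕ) (c ℓ : Level) : Set (lsuc (c ⊔ ℓ)) where
  field
    commRing : CommutativeRing c ℓ
  open CommutativeRing commRing public
  open RS (Semiring.rawSemiring semiring) public using (_^_; sum) renaming (_×_ to _·_)
  field
    nontrivial : ¬ (1# ≈ 0#)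
    inverse    : ∀ x → ¬ (x ≈ 0#) → ∃ λ y → x * y ≈ 1#
    charP      : (p · 1#) ≈ 0#
    algClosed  : ∀ (n : ℕ) (a : Fin (suc n) → Carrier) →
                 ∃ λ x → (x ^ suc n) + sum (λ i → a i * (x ^ Data.Fin.toℕ i)) ≈ 0#
    algebraic  : ∀ x → Σ ℕ λ n → ∃ λ (b : Fin (suc n) → ℕ) →
                 (x ^ suc n) + sum (λ i → (b i · 1#) * (x ^ Data.Fin.toℕ i)) ≈ 0#

W : ∀ {p c ℓ} → AlgClosureFp p c ℓ → ℕ → ℕ → Set (c ⊔ ℓ)
W F m n = ∃ λ (α : Fin n → Carrier) → (∀ i → (α i ^ m) ≈ 1#) × (sum α ≈ 0#)
  where open AlgClosureFp F

-- Membership in the subfield F_{p^k} ⊆ F: roots of x^(p^k) - x.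
InFpk : ∀ {p c ℓ} → (F : AlgClosureFp p c ℓ) → ℕ → AlgClosureFp.Carrier F → Set ℓ
InFpk {p} F k x = (x ^ (p Data.Nat.^ k)) ≈ x
  where open AlgClosureFp F

{-# OPTIONS --safe #-}

-- Let h = m′, d = d′, and let H be the group of h-th roots of unity in the finite field
-- K = F_p[ζ], where ζ ≠ 1 is an h-th root of unity.  Write S n for the set of sums of n
-- elements of H and c n for the number of H-cosets in S n ∖ {0}; there are at most d cosets.
--
-- Growth: S n + H has more cosets than S n unless S n already contains every nonzero
-- element.  Otherwise |S (n+1)| ≤ |S n| + 1, so each translate S n + t (t ∈ H) misses at
-- most one element of S (n+1); comparing the exceptional elements of three different
-- translates shows that S n ∪ {0} is closed under adding differences of elements of H,
-- and these span K.  Hence c n ≥ n until S n is full, and 0 ∈ S n for all n > d.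
--
-- If 0 ∉ S d then c n = n for all n < d, and the Frobenius map permutes the n cosets in S n.
-- This is too rigid: cosets fixed by Frobenius meet the prime field, those of period two
-- meet F_(p²) (when p² - 1 is prime to h), and counting them in a few sets S n is
-- contradictory outside the special cases.
--
-- Equality in the algebraically closed field is not decidable, so K is built as F_p[x]/g for
-- an irreducible factor g of 1 + x + ... + x^(h-1) found by search, and mapped to a root of g.

module Submission where

open import Defs
open import Algebra.Bundles using (CommutativeRing; RawRing)
open import Algebra.Solver.Ring.AlmostCommutativeRing
  using (fromCommutativeRing; _-Raw-AlmostCommutative⟶_)
open import Algebra.Structures using (IsCommutativeRing)
open import Data.Empty using (⊥)
open import Data.Fin as Fin using (Fin; toℕ; fromℕ; fromℕ<; inject₁)
open import Data.Fin.Properties using (toℕ-fromℕ; toℕ-fromℕ<; toℕ-inject₁; toℕ-injective; toℕ<n)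
open import Data.List as List using (List; []; _∷_; _++_; length; map; filter)
open import Data.List.Membership.Propositional using (_∈_; _∉_; find; lose)
open import Data.List.Membership.Propositional.Properties
  using (∈-∃++; ∈-++⁺ˡ; ∈-++⁺ʳ; ∈-++⁻; ∈-map⁻; ∈-filter⁺; ∈-filter⁻; ∈-cartesianProductWith⁺; ∈-allFin)
import Data.List.Membership.DecPropositional as DecMembership
open import Data.List.Properties using (length-++; length-map)
open import Data.List.Relation.Unary.All as All using (All; []; _∷_)
open import Data.List.Relation.Unary.All.Properties using (¬All⇒Any¬)
open import Data.List.Relation.Unary.AllPairs using ([]; _∷_)
open import Data.List.Relation.Unary.Any as Any using (here; there)
open import Data.List.Relation.Unary.Unique.Propositional using (Unique)
open import Data.List.Relation.Unary.Unique.Propositional.Properties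
  using (filter⁺; map⁺; ++⁺; cartesianProductWith⁺; allFin⁺)
open import Data.Maybe using (Maybe; just; nothing)
open import Data.Nat as ℕ using (ℕ; zero; suc; _≤_; _<_; z≤n; s≤s; _∸_; NonZero)
open import Data.Nat.Coprimality as Coprimality
  using (Coprime; coprime-Bézout; coprime-divisor; gcd≡1⇒coprime; prime⇒coprime)
open import Data.Nat.DivMod using (_%_; _/_; m≡m%n+[m/n]*n; m%n<n; m/n*n≡m)
open import Data.Nat.Divisibility
open import Data.Nat.GCD using (gcd; gcd[m,n]∣n; gcd-greatest; gcd[m,n]≡0⇒n≡0; module Bézout)
open import Data.Nat.Primality
  using (Prime; euclidsLemma; prime⇒irreducible; prime⇒nonTrivial; prime⇒nonZero; ¬prime[0]; ¬prime[1])
import Data.Nat.Properties as ℕ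
open import Data.Nat.Tactic.RingSolver using (solve-∀)
open import Data.Product using (∃; _×_; _,_; proj₁; proj₂)
open import Data.Sum using (_⊎_; inj₁; inj₂; [_,_]′)
open import Data.Vec as Vec using (Vec; []; _∷_; lookup; replicate)
import Data.Vec.Properties as Vec
open import Data.Vec.Functional using (Vector; tail)
open import Level using (Level; _⊔_)
open import Relation.Binary.Definitions using (DecidableEquality; tri<; tri≈; tri>)
import Relation.Binary.PropositionalEquality as ≡
open ≡ using (_≡_; _≢_)
open import Relation.Nullary using (¬_; Dec; contradiction; yes; no; ¬?)
open import Relation.Nullary.Decidable using (_×-dec_; map′; decidable-stable)
open import Relation.Unary using (Decidable)

-- Everything is proved for `m′` and `d′`: `m′` divides `m`, and minimality of `ℓ` makes `d′` a
-- divisor of `d`, so the results pass to `m`. Minimality also makes `h` prime to p^e - 1 for 1 ≤ e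
-- < ℓ. Taking h-th powers is then a bijection on the (p^e - 1)-st roots of unity in K; for e = 1
-- and e = 2 this singles out one representative of a coset of Frobenius period 1 or 2. The case e =
-- 2 requires ℓ ≥ 3. If ℓ = 2, then `h` divides p + 1 and the traces x + x^p take over; they collide
-- when ζ³ = 1, for then ζ + ζ⁻¹ = ζ² + ζ⁻², and vanishing sums of lengths 3 and p are combined
-- instead. The special cases are where there is too little room. For odd p, p - 1 divides `d`, so
-- outside (A) d ≥ 2(p - 1) > p, and `S p` must contain a coset that misses the prime field. For p =
-- 2 the contradiction arises in `S 4` and asks for d > 4; as `d` is odd, what remains is d = 1,
-- which is (A), and d = 3, which forces (B).

module Counting where
  open ≡ using (refl; sym; trans; cong; cong₂; subst; subst₂)

  -- Pigeonhole principles for lists without repetition.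

  module _ {a} {A : Set a} where

    ∷-unique : ∀ {x : A} {xs} → x ∉ xs → Unique xs → Unique (x ∷ xs)
    ∷-unique {x} {xs} x∉ u = All.tabulate (λ {y} y∈ x≡y → x∉ (subst (_∈ xs) (sym x≡y) y∈)) ∷ u

    unique-head : ∀ {x : A} {xs} → Unique (x ∷ xs) → x ∉ xs
    unique-head (h ∷ _) x∈ = All.lookup h x∈ refl

    unique-tail : ∀ {x : A} {xs} → Unique (x ∷ xs) → Unique xs
    unique-tail (_ ∷ u) = u

    length-⊆ : ∀ {xs ys : List A} → Unique xs → (∀ {z} → z ∈ xs → z ∈ ys) → length xs ≤ length ys
    length-⊆ {[]} _ _ = z≤n
    length-⊆ {x ∷ xs} u sub with ∈-∃++ (sub (here refl))
    ... | ls , rs , refl = ℕ.≤-trans (s≤s (length-⊆ (unique-tail u) sub′)) (ℕ.≤-reflexive eq)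
      where
      sub′ : ∀ {z} → z ∈ xs → z ∈ ls ++ rs
      sub′ {z} z∈ with ∈-++⁻ ls (sub (there z∈))
      ... | inj₁ q = ∈-++⁺ˡ q
      ... | inj₂ (here refl) = contradiction z∈ (unique-head u)
      ... | inj₂ (there q) = ∈-++⁺ʳ ls q
      eq : suc (length (ls ++ rs)) ≡ length (ls ++ x ∷ rs)
      eq = trans (cong suc (length-++ ls)) (trans (sym (ℕ.+-suc _ _)) (sym (length-++ ls)))

    missing : DecidableEquality A → ∀ {xs ys : List A} → Unique xs → length ys < length xs → ∃ λ z → z ∈ xs × z ∉ ys
    missing _≟_ {xs} {ys} u lt with All.all? (λ z → z ∈? ys) xs
      where open DecMembership _≟_ using (_∈?_)
    ... | yes all = contradiction (ℕ.≤-trans lt (length-⊆ u (All.lookup all))) ℕ.1+n≰n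
    ... | no ¬all = find (¬All⇒Any¬ (λ z → z ∈? ys) xs ¬all)
      where open DecMembership _≟_ using (_∈?_)

  module _ {a b r} {A : Set a} {B : Set b} (R : A → B → Set r) where

    private
      images : ∀ xs (ys : List B) → (∀ {x} → x ∈ xs → ∃ λ y → y ∈ ys × R x y) →
               (∀ {x x′ y} → x ∈ xs → x′ ∈ xs → R x y → R x′ y → x ≡ x′) → Unique xs →
               ∃ λ zs → Unique zs × length zs ≡ length xs ×
                 (∀ {z} → z ∈ zs → z ∈ ys × ∃ λ x → x ∈ xs × R x z)
      images [] ys tot inj u = [] , [] , refl , λ ()
      images (x ∷ xs) ys tot inj u
        with images xs ys (λ p → tot (there p)) (λ p q → inj (there p) (there q)) (unique-tail u) | tot (here refl)
      ... | zs , uz , len , sub | y , y∈ , Rxy =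
        y ∷ zs , ∷-unique (λ y∈zs → let (_ , x′ , x′∈ , Rx′y) = sub y∈zs in
                            unique-head u (subst (_∈ xs) (sym (inj (here refl) (there x′∈) Rxy Rx′y)) x′∈)) uz
        , cong suc len
        , λ { (here refl) → y∈ , x , here refl , Rxy
            ; (there p) → let (q , x′ , x′∈ , r′) = sub p in q , x′ , there x′∈ , r′ }

    -- A partner in `ys` is chosen for each entry of `xs`; the choices are distinct because no `y`
    -- is related to two entries. A relation in place of a function lets the partner depend on the
    -- proof of membership.
    length-injective : ∀ {xs ys} → Unique xs → (∀ {x} → x ∈ xs → ∃ λ y → y ∈ ys × R x y) →
      (∀ {x x′ y} → x ∈ xs → x′ ∈ xs → R x y → R x′ y → x ≡ x′) → length xs ≤ length ys
    length-injective {xs} {ys} u tot inj =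
      let (zs , uz , len , sub) = images xs ys tot inj u
      in ℕ.≤-trans (ℕ.≤-reflexive (sym len)) (length-⊆ uz (λ p → proj₁ (sub p)))

  module _ {a b} {A : Set a} {B : Set b} where

    -- Entries in equal positions. When one list is no longer than the other, this is an injection
    -- built from the lengths alone; it will send the cosets of `S (suc n)` to cosets of `S n`.
    data Matched : List A → List B → A → B → Set (a ⊔ b) where
      first : ∀ {x y xs ys} → Matched (x ∷ xs) (y ∷ ys) x y
      later : ∀ {x y x′ y′ xs ys} → Matched xs ys x y → Matched (x′ ∷ xs) (y′ ∷ ys) x y

    matched-∈ˡ : ∀ {xs ys x y} → Matched xs ys x y → x ∈ xs
    matched-∈ˡ first = here refl
    matched-∈ˡ (later m) = there (matched-∈ˡ m)

    matched-∈ʳ : ∀ {xs ys x y} → Matched xs ys x y → y ∈ ys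
    matched-∈ʳ first = here refl
    matched-∈ʳ (later m) = there (matched-∈ʳ m)

    matched-total : ∀ {xs ys} → length xs ≤ length ys → ∀ {x} → x ∈ xs → ∃ (Matched xs ys x)
    matched-total {_ ∷ _} {_ ∷ _} _ (here refl) = _ , first
    matched-total {_ ∷ _} {_ ∷ _} (s≤s le) (there p) = let (y , m) = matched-total le p in y , later m

    matched-injective : ∀ {xs ys} → Unique ys → ∀ {x x′ y} → Matched xs ys x y → Matched xs ys x′ y → x ≡ x′
    matched-injective u first first = refl
    matched-injective u first (later m) = contradiction (matched-∈ʳ m) (unique-head u)
    matched-injective u (later m) first = contradiction (matched-∈ʳ m) (unique-head u)
    matched-injective u (later m) (later m′) = matched-injective (unique-tail u) m m′

    map-unique : ∀ {f : A → B} {xs} → (∀ {x y} → x ∈ xs → y ∈ xs → f x ≡ f y → x ≡ y) → Unique xs → Unique (map f xs)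
    map-unique {xs = []} inj u = []
    map-unique {f} {x ∷ xs} inj u = ∷-unique
      (λ fx∈ → let (y , y∈ , e) = ∈-map⁻ f fx∈ in
        unique-head u (subst (_∈ xs) (sym (inj (here refl) (there y∈) e)) y∈))
      (map-unique (λ p q → inj (there p) (there q)) (unique-tail u))

open Counting

-- The coefficients (a , b) stand for a - b, with a decidable test for equality of coefficients, so
-- that the ring solver cancels terms although equality in R is not decidable.
module DifferenceSolver {c ℓ} (R : CommutativeRing c ℓ) where
  open CommutativeRing R
  open import Algebra.Properties.Semiring.Mult semiring
    using (×1-homo-*; ×-homo-+; ×-congˡ) renaming (_×_ to _·_)
  open import Algebra.Properties.Ring ring using (-‿distribˡ-*; -‿distribʳ-*)
  open import Algebra.Properties.AbelianGroup +-abelianGroup using (⁻¹-∙-comm; ⁻¹-involutive)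
  open import Algebra.Properties.CommutativeSemigroup +-commutativeSemigroup using (interchange)
  open import Relation.Binary.Reasoning.Setoid setoid

  Differences : RawRing _ _
  Differences = record
    { Carrier = ℕ × ℕ ; _≈_ = ≡._≡_
    ; _+_ = λ (a , b) (c , d) → a ℕ.+ c , b ℕ.+ d
    ; _*_ = λ (a , b) (c , d) → a ℕ.* c ℕ.+ b ℕ.* d , a ℕ.* d ℕ.+ b ℕ.* c
    ; -_ = λ (a , b) → b , a ; 0# = 0 , 0 ; 1# = 1 , 0 }

  value : ℕ × ℕ → Carrier
  value (a , b) = a · 1# + - (b · 1#)

  private
    +-homo : ∀ x y → value (RawRing._+_ Differences x y) ≈ value x + value y
    +-homo (a , b) (c , d) = begin
      (a ℕ.+ c) · 1# + - ((b ℕ.+ d) · 1#)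
        ≈⟨ +-cong (×-homo-+ 1# a c) (-‿cong (×-homo-+ 1# b d)) ⟩
      (a · 1# + c · 1#) + - (b · 1# + d · 1#)  ≈⟨ +-congˡ (⁻¹-∙-comm _ _) ⟨
      (a · 1# + c · 1#) + (- (b · 1#) + - (d · 1#))  ≈⟨ interchange _ _ _ _ ⟩
      value (a , b) + value (c , d) ∎

    +-* : ∀ a b c d → (a ℕ.* c ℕ.+ b ℕ.* d) · 1# ≈ a · 1# * (c · 1#) + b · 1# * (d · 1#)
    +-* a b c d = trans (×-homo-+ 1# (a ℕ.* c) (b ℕ.* d)) (+-cong (×1-homo-* a c) (×1-homo-* b d))

    expand : ∀ a b c d → (a + - b) * (c + - d) ≈ (a * c + b * d) + - (a * d + b * c)
    expand a b c d = begin
      (a + - b) * (c + - d)                    ≈⟨ distribʳ _ a (- b) ⟩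
      a * (c + - d) + - b * (c + - d)          ≈⟨ +-cong (distribˡ a c (- d)) (distribˡ (- b) c (- d)) ⟩
      (a * c + a * - d) + (- b * c + - b * - d)
        ≈⟨ +-cong (+-congˡ (sym (-‿distribʳ-* a d)))
             (+-cong (sym (-‿distribˡ-* b c))
                (trans (sym (-‿distribˡ-* b (- d))) (trans (-‿cong (sym (-‿distribʳ-* b d))) (⁻¹-involutive _)))) ⟩
      (a * c + - (a * d)) + (- (b * c) + b * d)  ≈⟨ +-congˡ (+-comm _ _) ⟩
      (a * c + - (a * d)) + (b * d + - (b * c))  ≈⟨ interchange _ _ _ _ ⟩
      (a * c + b * d) + (- (a * d) + - (b * c))  ≈⟨ +-congˡ (⁻¹-∙-comm _ _) ⟩
      (a * c + b * d) + - (a * d + b * c) ∎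

    *-homo : ∀ x y → value (RawRing._*_ Differences x y) ≈ value x * value y
    *-homo (a , b) (c , d) =
      trans (+-cong (+-* a b c d) (-‿cong (+-* a b d c))) (sym (expand _ _ _ _))

    neg-homo : ∀ x → value (RawRing.-_ Differences x) ≈ - value x
    neg-homo (a , b) = begin
      b · 1# + - (a · 1#)      ≈⟨ +-comm _ _ ⟩
      - (a · 1#) + b · 1#      ≈⟨ +-congˡ (⁻¹-involutive _) ⟨
      - (a · 1#) + - - (b · 1#) ≈⟨ ⁻¹-∙-comm _ _ ⟩
      - value (a , b) ∎

    homo : Differences -Raw-AlmostCommutative⟶ fromCommutativeRing R
    homo = record
      { ⟦_⟧ = value ; +-homo = +-homo ; *-homo = *-homo ; -‿homo = neg-homo
      ; 0-homo = -‿inverseʳ 0# ; 1-homo = trans (+-assoc _ _ _) (trans (+-congˡ (-‿inverseʳ 0#)) (+-identityʳ 1#)) }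

    same : ∀ x y → Maybe (value x ≈ value y)
    same (a , b) (c , d) with a ℕ.+ d ℕ.≟ c ℕ.+ b
    ... | no _   = nothing
    ... | yes eq = just (begin
      A + - B               ≈⟨ +-congʳ (trans (sym (+-identityʳ A)) (trans (+-congˡ (sym (-‿inverseʳ D))) (sym (+-assoc A D (- D))))) ⟩
      ((A + D) + - D) + - B ≈⟨ +-congʳ (+-congʳ (trans (sym (×-homo-+ 1# a d)) (trans (×-congˡ eq) (×-homo-+ 1# c b)))) ⟩
      ((C + B) + - D) + - B ≈⟨ +-assoc _ _ _ ⟩
      (C + B) + (- D + - B) ≈⟨ interchange _ _ _ _ ⟩
      (C + - D) + (B + - B) ≈⟨ trans (+-congˡ (-‿inverseʳ B)) (+-identityʳ _) ⟩
      C + - D ∎)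
      where A = a · 1#
            B = b · 1#
            C = c · 1#
            D = d · 1#

  open import Algebra.Solver.Ring Differences (fromCommutativeRing R) homo same public
    using (solve; _:=_; _:+_; _:*_; _:-_; :-_)

-- Binomial coefficients modulo p and additivity of the Frobenius map.

module BinomialDivisibility where
  open import Data.Nat.Combinatorics using (_C_; nCk≡n!/k![n-k]!; k![n∸k]!∣n!)
  open import Data.Nat using (_!)

  module _ {p : ℕ} (prime : Prime p) where

    p∤k! : ∀ {k} → k < p → ¬ (p ∣ k !)
    p∤k! {zero} _ p∣1 with ∣⇒≤ p∣1
    ... | s≤s z≤n = ¬prime[1] prime
    p∤k! {suc k} k<p p∣ with euclidsLemma (suc k) (k !) prime p∣
    ... | inj₁ q = ℕ.<⇒≱ k<p (∣⇒≤ q)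
    ... | inj₂ q = p∤k! (ℕ.<-trans (ℕ.n<1+n k) k<p) q

    -- p divides p! = (p C k) · k! (p - k)!, but neither of the two factorials on the right.
    p∣pCk : ∀ {k} → 0 < k → k < p → p ∣ p C k
    p∣pCk {k} 0<k k<p with euclidsLemma (p C k) (k ! ℕ.* (p ∸ k) !) prime p∣prod
      where
      instance _ = k ℕ.!* (p ∸ k) !≢0
      prod : (p C k) ℕ.* (k ! ℕ.* (p ∸ k) !) ≡ p !
      prod = ≡.trans (≡.cong (ℕ._* (k ! ℕ.* (p ∸ k) !)) (nCk≡n!/k![n-k]! (ℕ.<⇒≤ k<p)))
                     (m/n*n≡m (k![n∸k]!∣n! (ℕ.<⇒≤ k<p)))
      n∣n! : ∀ n → 0 < n → n ∣ n !
      n∣n! (suc n) _ = m∣m*n (n !)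
      p∣prod : p ∣ (p C k) ℕ.* (k ! ℕ.* (p ∸ k) !)
      p∣prod = ≡.subst (p ∣_) (≡.sym prod) (n∣n! p (ℕ.<-trans 0<k k<p))
    ... | inj₁ q = q
    ... | inj₂ q with euclidsLemma (k !) ((p ∸ k) !) prime q
    ... | inj₁ r = contradiction r (p∤k! k<p)
    ... | inj₂ r = contradiction r (p∤k! (ℕ.∸-monoʳ-< 0<k (ℕ.<⇒≤ k<p)))

open BinomialDivisibility

module Freshman {c ℓ} (R : CommutativeRing c ℓ) where
  open CommutativeRing R
  open import Data.Nat.Combinatorics using (nCn≡1)
  open import Algebra.Properties.Semiring.Exp semiring using (_^_)
  open import Algebra.Properties.Semiring.Mult semiring
    using (×-congˡ; ×-congʳ; ×-assoc-*; ×-homo-1; ×-assocˡ) renaming (_×_ to _·_)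
  open import Algebra.Properties.Semiring.Sum semiring using (sum; sum-cong-≋; sum-replicate-zero; sum-init-last)
  open import Algebra.Properties.CommutativeSemiring.Binomial commutativeSemiring using (theorem; binomialTerm)
  open import Relation.Binary.Reasoning.Setoid setoid

  sum-ends : ∀ n (t : Vector Carrier (2 ℕ.+ n)) → (∀ i → t (Fin.suc (inject₁ i)) ≈ 0#) →
             sum t ≈ t Fin.zero + t (fromℕ (suc n))
  sum-ends n t mid = +-congˡ (trans (sum-init-last (tail t))
    (trans (+-congʳ (trans (sum-cong-≋ mid) (sum-replicate-zero n))) (+-identityˡ _)))

  multiple-vanishes : ∀ {n} → n · 1# ≈ 0# → ∀ {m} → n ∣ m → ∀ x → m · x ≈ 0#
  multiple-vanishes {n} char (divides k ≡.refl) x = begin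
    (k ℕ.* n) · x  ≈⟨ ×-assocˡ x k n ⟨
    k · (n · x)    ≈⟨ ×-congʳ k (×-congʳ n (*-identityˡ x)) ⟨
    k · (n · (1# * x)) ≈⟨ ×-congʳ k (×-assoc-* n 1# x) ⟨
    k · (n · 1# * x) ≈⟨ ×-congʳ k (trans (*-congʳ char) (zeroˡ x)) ⟩
    k · 0#         ≈⟨ ·-zero k ⟩
    0# ∎
    where
    ·-zero : ∀ k → k · 0# ≈ 0#
    ·-zero zero = refl
    ·-zero (suc k) = trans (+-identityˡ _) (·-zero k)

  freshman : ∀ {p} → Prime p → p · 1# ≈ 0# → ∀ x y → (x + y) ^ p ≈ x ^ p + y ^ p
  freshman {zero} pr = contradiction pr ¬prime[0]
  freshman {suc zero} pr = contradiction pr ¬prime[1]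
  freshman {p@(suc (suc n))} pr char x y = begin
    (x + y) ^ p ≈⟨ theorem p x y ⟩
    sum (binomialTerm x y p) ≈⟨ sum-ends (suc n) (binomialTerm x y p) middle ⟩
    binomialTerm x y p Fin.zero + binomialTerm x y p (fromℕ p) ≈⟨ +-cong lowest highest ⟩
    y ^ p + x ^ p ≈⟨ +-comm _ _ ⟩
    x ^ p + y ^ p ∎
    where
    middle : ∀ (i : Fin (suc n)) → binomialTerm x y p (Fin.suc (inject₁ i)) ≈ 0#
    middle i = multiple-vanishes char
      (p∣pCk pr (s≤s z≤n) (s≤s (≡.subst (_< suc n) (≡.sym (toℕ-inject₁ i)) (toℕ<n i)))) _
    lowest : binomialTerm x y p Fin.zero ≈ y ^ p
    lowest = trans (×-homo-1 _) (*-identityˡ _)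
    highest : binomialTerm x y p (fromℕ p) ≈ x ^ p
    highest rewrite toℕ-fromℕ n | nCn≡1 p | ℕ.n∸n≡0 n = trans (×-homo-1 _) (*-identityʳ _)

-- Arithmetic of p, ℓ, h and d.

module Arithmetic where
  open import Data.Nat
  open import Data.Nat.Properties
  open ≡ using (refl; sym; trans; cong; cong₂; subst; subst₂)

  -- Bézout over ℕ comes with two sign patterns. If 1 + x h = y n, then x h is -1 modulo n and its
  -- square is 1, so b = x² h serves. The identity stays in ℕ because `b` and `k` become exponents.
  coprime-inverse : ∀ {h n} → Coprime h n → 1 ≤ h → ∃ λ b → ∃ λ k → h ℕ.* b ≡ 1 ℕ.+ n ℕ.* k
  coprime-inverse {h} {n} cop 1≤h with coprime-Bézout cop
  ... | Bézout.+- x y eq = x , y , trans (ℕ.*-comm h x) (trans (sym eq) (cong suc (ℕ.*-comm y n)))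
  ... | Bézout.-+ zero y eq = 1 , h ∸ 1 , trans (ℕ.*-identityʳ h)
          (trans (sym (ℕ.m+[n∸m]≡n 1≤h)) (cong suc (sym (trans (cong (ℕ._* (h ∸ 1)) n≡1) (ℕ.*-identityˡ _)))))
    where n≡1 = ℕ.m*n≡1⇒n≡1 y n (sym eq)
  coprime-inverse {suc h} {n} cop _ | Bézout.-+ (suc x) y eq =
    suc x ℕ.* suc x ℕ.* suc h , s ℕ.* y , trans (square x h) (trans (cong (λ e → 1 ℕ.+ s ℕ.* e) eq) (regroup s y n))
    where
    s = h ℕ.+ x ℕ.* suc h
    square : ∀ x h → suc h ℕ.* (suc x ℕ.* suc x ℕ.* suc h) ≡
             1 ℕ.+ (h ℕ.+ x ℕ.* suc h) ℕ.* (1 ℕ.+ suc x ℕ.* suc h)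
    square = solve-∀
    regroup : ∀ s y n → 1 ℕ.+ s ℕ.* (y ℕ.* n) ≡ 1 ℕ.+ n ℕ.* (s ℕ.* y)
    regroup = solve-∀

  product-pred : ∀ {x y} → 1 ≤ x → 1 ≤ y → x * y ∸ 1 ≡ x * (y ∸ 1) + (x ∸ 1)
  product-pred {suc x} {suc y} _ _ = identity x y
    where
    identity : ∀ x y → y + x * suc y ≡ suc x * y + x
    identity = solve-∀

  pred∣power-pred : ∀ {x} → 1 ≤ x → ∀ k → x ∸ 1 ∣ x ^ k ∸ 1
  pred∣power-pred x≥1 zero = _ ∣0
  pred∣power-pred {x} x≥1 (suc k) = subst (x ∸ 1 ∣_) (sym (product-pred x≥1 (m^n>0 x {{>-nonZero x≥1}} k)))
    (∣m∣n⇒∣m+n (∣n⇒∣m*n x (pred∣power-pred x≥1 k)) ∣-refl)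

  -- One step of Euclid's algorithm on exponents: if k = s + a j, then p^k - 1 = p^s ((p^a)^j - 1) +
  -- (p^s - 1).
  ∣power-pred-% : ∀ {p r} → 1 ≤ p → ∀ a k .{{_ : NonZero a}} → r ∣ p ^ a ∸ 1 → r ∣ p ^ k ∸ 1 → r ∣ p ^ (k % a) ∸ 1
  ∣power-pred-% {p} {r} p≥1 a k r∣a r∣k = ∣m+n∣m⇒∣n
    (subst (r ∣_) (trans (cong (_∸ 1) split) (product-pred (m^n>0 p (k % a)) (m^n>0 (p ^ a) {{m^n≢0 p a}} (k / a)))) r∣k)
    (∣n⇒∣m*n (p ^ (k % a)) (∣-trans r∣a (pred∣power-pred (m^n>0 p a) (k / a))))
    where
    instance _ = >-nonZero p≥1
    split : p ^ k ≡ p ^ (k % a) * (p ^ a) ^ (k / a)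
    split = trans (cong (p ^_) (trans (m≡m%n+[m/n]*n k a) (cong (k % a +_) (*-comm (k / a) a))))
      (trans (^-distribˡ-+-* p (k % a) _) (cong (p ^ (k % a) *_) (sym (^-*-assoc p a (k / a)))))

  -- The Frobenius number of 3 and p is 2p - 3.
  three-and-p : ∀ {p n} → 1 ≤ p → ¬ 3 ∣ p → 2 * (p ∸ 1) ≤ n → ∃ λ a → ∃ λ b → n ≡ a * 3 + b * p
  three-and-p {p} {n} p≥1 3∤p le = subst (λ n → ∃ λ a → ∃ λ b → n ≡ a * 3 + b * p) (m+[n∸m]≡n le)
    (go (n ∸ 2 * (p ∸ 1)))
    where
    cases : ∀ q r i j → 1 ≤ r → r < 3 → i < 3 → ∃ λ a → ∃ λ b → 2 * (r + q * 3 ∸ 1) + (i + j * 3) ≡ a * 3 + b * (r + q * 3)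
    cases q 1 0 j _ _ _ = 2 * q + j , 0 , eq q j
      where eq : ∀ q j → 2 * (q * 3) + (0 + j * 3) ≡ (2 * q + j) * 3 + 0 * (1 + q * 3)
            eq = solve-∀
    cases q 1 1 j _ _ _ = q + j , 1 , eq q j
      where eq : ∀ q j → 2 * (q * 3) + (1 + j * 3) ≡ (q + j) * 3 + 1 * (1 + q * 3)
            eq = solve-∀
    cases q 1 2 j _ _ _ = j , 2 , eq q j
      where eq : ∀ q j → 2 * (q * 3) + (2 + j * 3) ≡ j * 3 + 2 * (1 + q * 3)
            eq = solve-∀
    cases q 2 0 j _ _ _ = q + j , 1 , eq q j
      where eq : ∀ q j → 2 * (1 + q * 3) + (0 + j * 3) ≡ (q + j) * 3 + 1 * (2 + q * 3)
            eq = solve-∀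
    cases q 2 1 j _ _ _ = 1 + 2 * q + j , 0 , eq q j
      where eq : ∀ q j → 2 * (1 + q * 3) + (1 + j * 3) ≡ (1 + 2 * q + j) * 3 + 0 * (2 + q * 3)
            eq = solve-∀
    cases q 2 2 j _ _ _ = j , 2 , eq q j
      where eq : ∀ q j → 2 * (1 + q * 3) + (2 + j * 3) ≡ j * 3 + 2 * (2 + q * 3)
            eq = solve-∀
    cases q (suc (suc (suc r))) i j _ (s≤s (s≤s (s≤s ()))) _
    cases q 1 (suc (suc (suc i))) j _ _ (s≤s (s≤s (s≤s ())))
    cases q 2 (suc (suc (suc i))) j _ _ (s≤s (s≤s (s≤s ())))
    p%3≥1 : 1 ≤ p % 3
    p%3≥1 = n≢0⇒n>0 (λ e → 3∤p (m%n≡0⇒n∣m p 3 e))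
    go : ∀ k → ∃ λ a → ∃ λ b → 2 * (p ∸ 1) + k ≡ a * 3 + b * p
    go k = subst₂ (λ p k → ∃ λ a → ∃ λ b → 2 * (p ∸ 1) + k ≡ a * 3 + b * p)
      (sym (m≡m%n+[m/n]*n p 3)) (sym (m≡m%n+[m/n]*n k 3))
      (cases (p / 3) (p % 3) (k % 3) (k / 3) p%3≥1 (m%n<n p 3) (m%n<n k 3))

  module Parameters {p m ℓ h d k D : ℕ} (p-prime : Prime p) (m≥3 : 3 ≤ m) (p⊥m : gcd p m ≡ 1) (p-1⊥m : gcd (p ∸ 1) m ≡ 1)
    (ℓ≥1 : 1 ≤ ℓ) (ℓ-works : 1 < gcd (p ^ ℓ ∸ 1) m) (ℓ-least : ∀ e → 1 ≤ e → e < ℓ → ¬ (1 < gcd (p ^ e ∸ 1) m))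
    (h≡ : h ≡ gcd (p ^ ℓ ∸ 1) m) (dh≡ : d * h ≡ p ^ ℓ ∸ 1) (k≥1 : 1 ≤ k) (Dm≡ : D * m ≡ p ^ k ∸ 1) where

    p≥2 : 2 ≤ p
    p≥2 = nonTrivial⇒n>1 p {{prime⇒nonTrivial p-prime}}

    p≥1 : 1 ≤ p
    p≥1 = <⇒≤ p≥2

    private instance
      p-nonZero : NonZero p
      p-nonZero = prime⇒nonZero p-prime

    h>1 : 1 < h
    h>1 = subst (1 <_) (sym h≡) ℓ-works

    h≥1 : 1 ≤ h
    h≥1 = <⇒≤ h>1

    h∣m : h ∣ m
    h∣m = subst (_∣ m) (sym h≡) (gcd[m,n]∣n (p ^ ℓ ∸ 1) m)

    h∣q-1 : h ∣ p ^ ℓ ∸ 1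
    h∣q-1 = subst (h ∣_) dh≡ (n∣m*n d)

    private
      power-pred>0 : ∀ {e} → 1 ≤ e → 1 ≤ p ^ e ∸ 1
      power-pred>0 {suc e} _ = ∸-monoˡ-≤ 1 (≤-trans p≥2 (m≤m*n p (p ^ e) {{m^n≢0 p e}}))

      factor>0 : ∀ {a b c} → a * b ≡ c → 1 ≤ c → 1 ≤ a
      factor>0 {zero} refl ()
      factor>0 {suc a} _ _ = s≤s z≤n

    d≥1 : 1 ≤ d
    d≥1 = factor>0 dh≡ (power-pred>0 ℓ≥1)

    -- A common divisor also divides gcd (p^e - 1, m), which minimality of `ℓ` forbids to exceed 1.
    -- The value 0 has to be excluded separately; it would make `m` zero.
    h⊥small : ∀ {e} → 1 ≤ e → e < ℓ → Coprime h (p ^ e ∸ 1)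
    h⊥small {e} e≥1 e<ℓ {i} (i∣h , i∣) with gcd (p ^ e ∸ 1) m | ℓ-least e e≥1 e<ℓ
        | gcd-greatest i∣ (∣-trans i∣h h∣m) | (λ (q : gcd (p ^ e ∸ 1) m ≡ 0) → gcd[m,n]≡0⇒n≡0 (p ^ e ∸ 1) q)
    ... | 0 | _ | _ | m≡0 = contradiction (subst (3 ≤_) (m≡0 refl) m≥3) λ ()
    ... | 1 | _ | i∣1 | _ = ∣1⇒≡1 i∣1
    ... | suc (suc g) | ¬>1 | _ | _ = contradiction (s≤s (s≤s z≤n)) ¬>1

    ℓ≥2 : 2 ≤ ℓ
    ℓ≥2 = ≤∧≢⇒< ℓ≥1 λ { refl → n≮n 1 (subst (1 <_) (trans (cong (λ q → gcd (q ∸ 1) m) (*-identityʳ p)) p-1⊥m) ℓ-works) }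

    h⊥p : Coprime h p
    h⊥p (i∣h , i∣p) = gcd≡1⇒coprime p⊥m (i∣p , ∣-trans i∣h h∣m)

    h⊥p-1 : Coprime h (p ∸ 1)
    h⊥p-1 = subst (λ q → Coprime h (q ∸ 1)) (*-identityʳ p) (h⊥small ≤-refl ℓ≥2)

    h⊥p²-1 : 3 ≤ ℓ → Coprime h (p * p ∸ 1)
    h⊥p²-1 ℓ≥3 = subst (λ q → Coprime h (p * q ∸ 1)) (*-identityʳ p) (h⊥small (s≤s z≤n) ℓ≥3)

    -- Either p is 2, or 2 divides p - 1, and `h` is prime to both p and p - 1.
    h⊥2 : Coprime h 2
    h⊥2 {i} (i∣h , i∣2) with p ≟ 2
    ... | yes refl = h⊥p (i∣h , i∣2)
    ... | no p≢2 = h⊥p-1 (i∣h , ∣-trans i∣2 (divides (p / 2) (cong (_∸ 1) odd)))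
      where
      odd : p ≡ 1 + p / 2 * 2
      odd with p % 2 in eq | m≡m%n+[m/n]*n p 2 | m%n<n p 2
      ... | 1 | e | _ = e
      ... | suc (suc _) | _ | s≤s (s≤s ())
      ... | 0 | e | _ with prime⇒irreducible p-prime (m%n≡0⇒n∣m p 2 eq)
      ...   | inj₂ 2≡p = contradiction (sym 2≡p) p≢2

    p-1∣d : p ∸ 1 ∣ d
    p-1∣d = coprime-divisor (Coprimality.sym h⊥p-1)
      (subst (p ∸ 1 ∣_) (trans (sym dh≡) (*-comm d h)) (pred∣power-pred p≥1 ℓ))

    2[p-1]≤d : d ≢ p ∸ 1 → 2 * (p ∸ 1) ≤ d
    2[p-1]≤d d≢ with p-1∣d
    ... | divides 0 e = contradiction (subst (1 ≤_) e d≥1) λ ()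
    ... | divides 1 e = contradiction (trans e (*-identityˡ _)) d≢
    ... | divides (suc (suc q)) e = subst (2 * (p ∸ 1) ≤_) (sym e) (*-monoˡ-≤ (p ∸ 1) (s≤s (s≤s (z≤n {q}))))

    h∣p+1 : ℓ ≡ 2 → h ∣ suc p
    h∣p+1 refl = coprime-divisor h⊥p-1 (subst (h ∣_) (trans (cong (λ q → p * q ∸ 1) (*-identityʳ p)) (square p p≥1)) h∣q-1)
      where
      square : ∀ p → 1 ≤ p → p * p ∸ 1 ≡ (p ∸ 1) * suc p
      square (suc p) _ = identity p
        where identity : ∀ p → p + p * suc p ≡ p * suc (suc p)
              identity = solve-∀

    2∤d : p ≡ 2 → ¬ 2 ∣ d
    2∤d refl 2∣d = contradiction (∣1⇒≡1 (∣m+n∣m⇒∣n {2} (subst (2 ∣_) (sym (m∸n+n≡m (m^n>0 2 ℓ))) (2∣2^ ℓ≥1))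
      (subst (2 ∣_) dh≡ (∣m⇒∣m*n h 2∣d)))) λ ()
      where
      2∣2^ : ∀ {ℓ} → 1 ≤ ℓ → 2 ∣ 2 ^ ℓ
      2∣2^ {suc ℓ} _ = m∣m*n (2 ^ ℓ)

    -- Since 3 divides 2^ℓ - 1, ℓ is even, say 2 j. Then 2^j - 1 divides 3 h and is prime to `h`, so
    -- it divides 3 and j ≤ 2. For j = 1 one would get h = 1; j = 2 gives 3 h = 15.
    exceptional : p ≡ 2 → d ≡ 3 → h ≡ 5
    exceptional refl refl = even (ℓ % 2) (ℓ / 2) (m≡m%n+[m/n]*n ℓ 2) (m%n<n ℓ 2)
        (∣power-pred-% {2} {3} (s≤s z≤n) 2 ℓ ∣-refl (subst (3 ∣_) dh≡ (m∣m*n h)))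
      where
      cancel : ∀ n → 3 * h ≡ 3 * n → h ≡ n
      cancel n = *-cancelˡ-≡ h n 3
      even : ∀ r j → ℓ ≡ r + j * 2 → r < 2 → 3 ∣ 2 ^ r ∸ 1 → h ≡ 5
      even 1 j _ _ 3∣1 = contradiction (∣⇒≤ 3∣1) λ { (s≤s ()) }
      even (suc (suc r)) j _ (s≤s (s≤s ())) _
      even 0 0 refl _ _ = contradiction ℓ≥1 λ ()
      even 0 1 refl _ _ = contradiction (subst (1 <_) (cancel 1 dh≡) h>1) λ { (s≤s ()) }
      even 0 2 refl _ _ = cancel 5 dh≡
      even 0 j@(suc (suc (suc i))) refl _ _ = contradiction (≤-trans 7≤ (∣⇒≤ divides-3)) λ { (s≤s (s≤s (s≤s ()))) }
        where
        7≤ : 7 ≤ 2 ^ j ∸ 1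
        7≤ = ∸-monoˡ-≤ 1 (^-monoʳ-≤ 2 (s≤s (s≤s (s≤s (z≤n {i})))))
        j<ℓ : j < j * 2
        j<ℓ = m<m*n j 2 (s≤s (s≤s z≤n))
        divides-3 : 2 ^ j ∸ 1 ∣ 3
        divides-3 = coprime-divisor (Coprimality.sym (h⊥small (s≤s z≤n) j<ℓ))
          (subst (2 ^ j ∸ 1 ∣_) (trans (cong (_∸ 1) (^-*-assoc 2 j 2)) (trans (sym dh≡) (*-comm 3 h)))
            (pred∣power-pred (m^n>0 2 j) 2))

    -- In fact `d` divides `D`. Reducing k modulo ℓ and using minimality shows that ℓ divides k, so
    -- d h divides D m; then `h` is cancelled and the cofactor m / h is prime to `d`.
    d≤D : d ≤ D
    d≤D = ∣⇒≤ {{>-nonZero (factor>0 Dm≡ (power-pred>0 k≥1))}} d∣D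
      where
      instance
        ℓ-nonZero : NonZero ℓ
        ℓ-nonZero = >-nonZero ℓ≥1
        h-nonZero : NonZero h
        h-nonZero = >-nonZero h≥1
      h∣ : h ∣ p ^ (k % ℓ) ∸ 1
      h∣ = ∣power-pred-% p≥1 ℓ k h∣q-1 (∣-trans h∣m (subst (m ∣_) Dm≡ (n∣m*n D)))
      k%ℓ≡0 : k % ℓ ≡ 0
      k%ℓ≡0 with k % ℓ | h∣ | m%n<n k ℓ
      ... | 0 | _ | _ = refl
      ... | suc r | h∣r | r<ℓ = contradiction (h⊥small (s≤s z≤n) r<ℓ (∣-refl , h∣r)) λ h≡1 → n≮n 1 (subst (1 <_) h≡1 h>1)
      q-1∣ : p ^ ℓ ∸ 1 ∣ p ^ k ∸ 1
      q-1∣ = subst (λ e → p ^ ℓ ∸ 1 ∣ e ∸ 1)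
        (trans (^-*-assoc p ℓ (k / ℓ)) (cong (p ^_) (trans (*-comm ℓ _) (sym (trans (m≡m%n+[m/n]*n k ℓ) (cong (_+ k / ℓ * ℓ) k%ℓ≡0))))))
        (pred∣power-pred (m^n>0 p ℓ) (k / ℓ))
      d∣D : d ∣ D
      d∣D with h∣m
      ... | divides g m≡gh = coprime-divisor d⊥g (subst (d ∣_) (*-comm D g) (*-cancelʳ-∣ h
              (subst₂ _∣_ (sym dh≡) (trans (sym Dm≡) (trans (cong (D *_) m≡gh) (sym (*-assoc D g h)))) q-1∣)))
        where
        -- If i divides both, then i h divides p^ℓ - 1 and m, hence their greatest common divisor h.
        d⊥g : Coprime d g
        d⊥g {i} (i∣d , i∣g) = ∣1⇒≡1 (*-cancelʳ-∣ h (subst (i * h ∣_) (trans (sym h≡) (sym (*-identityˡ h)))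
          (gcd-greatest (subst (i * h ∣_) dh≡ (*-monoʳ-∣′ i∣d)) (subst (i * h ∣_) (sym m≡gh) (*-monoʳ-∣′ i∣g)))))
          where
          *-monoʳ-∣′ : ∀ {a b} → a ∣ b → a * h ∣ b * h
          *-monoʳ-∣′ = *-monoˡ-∣ h

open Arithmetic using (coprime-inverse; three-and-p; module Parameters)

-- Discrete finite fields, roots of polynomials and the Frobenius map.

record FiniteField : Set₁ where
  infixl 7 _*_
  infixl 6 _+_
  infix  8 -_
  infix  4 _≟_
  field
    Carrier           : Set
    _+_ _*_           : Carrier → Carrier → Carrier
    -_                : Carrier → Carrier
    0# 1#             : Carrier
    isCommutativeRing : IsCommutativeRing _≡_ _+_ _*_ -_ 0# 1#
    1≢0               : 1# ≢ 0#
    invert            : ∀ x → x ≢ 0# → ∃ λ y → x * y ≡ 1#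
    _≟_               : DecidableEquality Carrier
    elements          : List Carrier
    elements-unique   : Unique elements
    complete          : ∀ x → x ∈ elements

  commutativeRing : CommutativeRing _ _
  commutativeRing = record { isCommutativeRing = isCommutativeRing }

module FieldProperties (K : FiniteField) where
  open ≡ using (refl; sym; trans; cong; cong₂; subst; subst₂)
  open FiniteField K public using (commutativeRing; 1≢0; invert; _≟_; elements; elements-unique; complete)
  open CommutativeRing commutativeRing public using (Carrier; _+_; _*_; -_; _-_; 0#; 1#;
    +-assoc; +-comm; +-identityˡ; +-identityʳ; *-assoc; *-comm; *-identityˡ; *-identityʳ; zeroˡ; zeroʳ;
    -‿inverseˡ; -‿inverseʳ; distribˡ; distribʳ; semiring; commutativeSemiring; ring)
  open import Algebra.Properties.Semiring.Exp semiring public using (_^_; ^-homo-*; ^-assocʳ)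
  open import Algebra.Properties.CommutativeSemiring.Exp commutativeSemiring public using (^-distrib-*)
  open import Algebra.Properties.Semiring.Mult semiring public using (×1-homo-*; ×-homo-+) renaming (_×_ to _·_)
  open DifferenceSolver commutativeRing public
  open Freshman commutativeRing public using (freshman)

  1^ : ∀ n → 1# ^ n ≡ 1#
  1^ zero = refl
  1^ (suc n) = trans (*-identityˡ _) (1^ n)

  1^′ : ∀ {x} m n → x ^ m ≡ 1# → x ^ (m ℕ.* n) ≡ 1#
  1^′ {x} m n e = trans (sym (^-assocʳ x m n)) (trans (cong (_^ n) e) (1^ n))

  cancelˡ : ∀ {x y z} → x ≢ 0# → x * y ≡ x * z → y ≡ z
  cancelˡ {x} {y} {z} x≢0 e with invert x x≢0
  ... | i , xi = trans (sym (undo y)) (trans (cong (i *_) e) (undo z))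
    where
    undo : ∀ y → i * (x * y) ≡ y
    undo y = trans (sym (*-assoc i x y)) (trans (cong (_* y) (trans (*-comm i x) xi)) (*-identityˡ y))

  product-≢0 : ∀ {x y} → x ≢ 0# → y ≢ 0# → x * y ≢ 0#
  product-≢0 x≢0 y≢0 e = y≢0 (cancelˡ x≢0 (trans e (sym (zeroʳ _))))

  ^-≢0 : ∀ {x} n → x ≢ 0# → x ^ n ≢ 0#
  ^-≢0 zero _ = 1≢0
  ^-≢0 (suc n) x≢0 = product-≢0 x≢0 (^-≢0 n x≢0)

  0^ : ∀ n → 1 ≤ n → 0# ^ n ≡ 0#
  0^ (suc n) _ = zeroˡ _

  unit-≢0 : ∀ {x} n → 1 ≤ n → x ^ n ≡ 1# → x ≢ 0#
  unit-≢0 n n≥1 e refl = 1≢0 (trans (sym e) (0^ n n≥1))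

  sub-≡0 : ∀ {x y} → x - y ≡ 0# → x ≡ y
  sub-≡0 {x} {y} e = trans (solve 2 (λ x y → x := (x :- y) :+ y) refl x y) (trans (cong (_+ y) e) (+-identityˡ y))

  +-cancelʳ : ∀ {x y} z → x + z ≡ y + z → x ≡ y
  +-cancelʳ {x} {y} z e = trans (back x) (trans (cong (_- z) e) (sym (back y)))
    where back : ∀ x → x ≡ (x + z) - z
          back x = solve 2 (λ x z → x := (x :+ z) :- z) refl x z

  module _ {h n b k : ℕ} (inv : h ℕ.* b ≡ 1 ℕ.+ n ℕ.* k) where

    -- `b` inverts `h` modulo `n`, so on the n-th roots of unity the maps x ↦ x^h and x ↦ x^b are
    -- inverse to each other.
    root-power : ∀ {x} → x ^ n ≡ 1# → (x ^ h) ^ b ≡ x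
    root-power {x} e = trans (^-assocʳ x h b) (trans (cong (x ^_) inv)
      (trans (cong (x *_) (1^′ n k e)) (*-identityʳ x)))

    power-root : ∀ {x} → x ^ n ≡ 1# → (x ^ b) ^ h ≡ x
    power-root {x} e = trans (trans (^-assocʳ x b h) (trans (cong (x ^_) (ℕ.*-comm b h)) (sym (^-assocʳ x h b))))
      (root-power e)

  coprime-orders : ∀ {x m n} → Coprime m n → 1 ≤ m → x ^ m ≡ 1# → x ^ n ≡ 1# → x ≡ 1#
  coprime-orders {x} {m} {n} cop m≥1 em en with coprime-inverse cop m≥1
  ... | b , k , inv = trans (sym (root-power {m} {n} {b} {k} inv en)) (trans (cong (_^ b) em) (1^ b))

  -- Monic polynomials: the leading coefficient 1 is not stored.
  monic : ∀ {n} → Vec Carrier n → Carrier → Carrier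
  monic []       x = 1#
  monic (c ∷ cs) x = c + x * monic cs x

  -- Synthetic division by x - a: the coefficients of the quotient are the partial Horner values at
  -- `a`.
  deflate : ∀ {n} → Vec Carrier (suc n) → Carrier → Vec Carrier n
  deflate (c ∷ [])       a = []
  deflate (c ∷ c′ ∷ cs) a = monic (c′ ∷ cs) a ∷ deflate (c′ ∷ cs) a

  deflate-correct : ∀ {n} (cs : Vec Carrier (suc n)) a x →
    monic cs x ≡ monic cs a + (x - a) * monic (deflate cs a) x
  deflate-correct (c ∷ []) a x =
    solve 4 (λ c a x o → c :+ x :* o := c :+ a :* o :+ (x :- a) :* o) refl c a x 1#
  deflate-correct (c ∷ c′ ∷ cs) a x =
    trans (cong (λ e → c + x * e) (deflate-correct (c′ ∷ cs) a x))
      (solve 5 (λ c a x m q → c :+ x :* (m :+ (x :- a) :* q) := c :+ a :* m :+ (x :- a) :* (m :+ x :* q))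
        refl c a x _ _)

  roots-bound : ∀ {n} (cs : Vec Carrier n) {xs} → Unique xs → (∀ {x} → x ∈ xs → monic cs x ≡ 0#) → length xs ≤ n
  roots-bound cs {[]} _ _ = z≤n
  roots-bound [] {x ∷ xs} _ root = contradiction (root (here refl)) 1≢0
  roots-bound (c ∷ cs) {a ∷ xs} u root = s≤s (roots-bound (deflate (c ∷ cs) a) (unique-tail u) root′)
    where
    root′ : ∀ {x} → x ∈ xs → monic (deflate (c ∷ cs) a) x ≡ 0#
    root′ {x} x∈ = cancelˡ {x - a}
      (λ e → unique-head u (subst (_∈ xs) (sub-≡0 e) x∈))
      (trans (sym (+-identityˡ _)) (trans (cong (_+ (x - a) * monic (deflate (c ∷ cs) a) x) (sym (root (here refl))))
        (trans (sym (deflate-correct (c ∷ cs) a x)) (trans (root (there x∈)) (sym (zeroʳ _))))))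

  x^n-1 : ∀ n → Vec Carrier n
  x^n-1 zero    = []
  x^n-1 (suc n) = - 1# ∷ replicate n 0#

  monic-zeros : ∀ n x → monic (replicate n 0#) x ≡ x ^ n
  monic-zeros zero x = refl
  monic-zeros (suc n) x = trans (+-identityˡ _) (cong (x *_) (monic-zeros n x))

  roots-of-unity-bound : ∀ n → 1 ≤ n → ∀ {xs} → Unique xs → (∀ {x} → x ∈ xs → x ^ n ≡ 1#) → length xs ≤ n
  roots-of-unity-bound (suc n) _ u e = roots-bound (x^n-1 (suc n)) u
    (λ {x} x∈ → trans (cong (λ z → - 1# + x * z) (monic-zeros n x))
      (trans (cong (- 1# +_) (e x∈)) (-‿inverseˡ 1#)))

  pred : ∀ {x} n → 1 ≤ n → x ≢ 0# → x ^ n ≡ x → x ^ (n ∸ 1) ≡ 1#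
  pred {x} (suc n) _ x≢0 e = cancelˡ x≢0 (trans e (sym (*-identityʳ x)))

  multiple-≢0 : ∀ {m n} → Coprime m n → 1 ≤ m → n · 1# ≡ 0# → m · 1# ≢ 0#
  multiple-≢0 {m} {n} cop m≥1 n0 m0 with coprime-inverse cop m≥1
  ... | b , k , inv = 1≢0 (trans (sym (trans (cong (1# +_) (trans (×1-homo-* n k) (trans (cong (_* k · 1#) n0) (zeroˡ _))))
          (+-identityʳ 1#))) (trans (cong (_· 1#) (sym inv)) (trans (×1-homo-* m b) (trans (cong (_* b · 1#) m0) (zeroˡ _)))))

  -- Sums of powers without coefficients or signs: in characteristic p a coefficient from the prime
  -- field is a repeated summand.
  data Span (x : Carrier) : Carrier → Set where
    []  : Span x 0#
    _∷_ : ∀ i {y} → Span x y → Span x (x ^ i + y)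

  module Characteristic {p} (p-prime : Prime p) (char : p · 1# ≡ 0#) where

    frobenius-+ : ∀ x y → (x + y) ^ p ≡ x ^ p + y ^ p
    frobenius-+ = freshman p-prime char

    0^p : 0# ^ p ≡ 0#
    0^p = +-cancelʳ (0# ^ p) (trans (sym (frobenius-+ 0# 0#))
      (trans (cong (_^ p) (+-identityˡ 0#)) (sym (+-identityˡ _))))

    frobenius-iterate : ∀ e x y → (x + y) ^ (p ℕ.^ e) ≡ x ^ (p ℕ.^ e) + y ^ (p ℕ.^ e)
    frobenius-iterate zero x y = trans (*-identityʳ _) (cong₂ _+_ (sym (*-identityʳ x)) (sym (*-identityʳ y)))
    frobenius-iterate (suc e) x y = trans (sym (^-assocʳ (x + y) p q))
      (trans (cong (_^ q) (frobenius-+ x y)) (trans (frobenius-iterate e (x ^ p) (y ^ p))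
        (cong₂ _+_ (^-assocʳ x p q) (^-assocʳ y p q))))
      where q = p ℕ.^ e

    0^p^ : ∀ e → 0# ^ (p ℕ.^ e) ≡ 0#
    0^p^ zero = *-identityʳ 0#
    0^p^ (suc e) = trans (sym (^-assocʳ 0# p (p ℕ.^ e))) (trans (cong (_^ (p ℕ.^ e)) 0^p) (0^p^ e))

    -- x ↦ x^(p^e) is additive, so if it fixes ζ it fixes all sums of powers of ζ. For e = ℓ this
    -- gives y^(h d) = 1 for every nonzero y of K.
    spanned-fixed : ∀ {ζ} e → ζ ^ (p ℕ.^ e) ≡ ζ → ∀ {y} → Span ζ y → y ^ (p ℕ.^ e) ≡ y
    spanned-fixed e eq [] = 0^p^ e
    spanned-fixed {ζ} e eq (_∷_ i {y} sp) = trans (frobenius-iterate e (ζ ^ i) y) (cong₂ _+_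
      (trans (^-assocʳ ζ i q) (trans (cong (ζ ^_) (ℕ.*-comm i q)) (trans (sym (^-assocʳ ζ q i)) (cong (_^ i) eq))))
      (spanned-fixed e eq sp))
      where q = p ℕ.^ e

-- Sumsets of the group of h-th roots of unity.

module SumsOfRootsOfUnity (K : FiniteField) where
  open ≡ using (refl; sym; trans; cong; cong₂; subst; subst₂)
  open FieldProperties K

  module Sumsets {p h d : ℕ} (p-prime : Prime p) (char : p · 1# ≡ 0#)
    (h≥1 : 1 ≤ h) (d≥1 : 1 ≤ d) (order : ∀ y → y ≢ 0# → y ^ (h ℕ.* d) ≡ 1#)
    {ζ : Carrier} (ζ^h≡1 : ζ ^ h ≡ 1#) (ζ≢1 : ζ ≢ 1#) (square-roots : ∀ {x} → x ^ h ≡ 1# → x ^ 2 ≡ 1# → x ≡ 1#) (span : ∀ y → Span ζ y)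
    where

    ζ²≢ζ⁰ : ζ ^ 2 ≢ 1#
    ζ²≢ζ⁰ e = ζ≢1 (square-roots ζ^h≡1 e)

    open Characteristic p-prime char public using (frobenius-+; 0^p)

    frobenius-sub : ∀ x y → (x - y) ^ p ≡ x ^ p - y ^ p
    frobenius-sub x y = trans (solve 2 (λ a b → a := (a :+ b) :- b) refl _ (y ^ p))
      (cong (_- y ^ p) (trans (sym (frobenius-+ (x - y) y))
        (cong (_^ p) (solve 2 (λ x y → (x :- y) :+ y := x) refl x y))))

    frobenius-injective : ∀ {x y} → x ^ p ≡ y ^ p → x ≡ y
    frobenius-injective {x} {y} e = decidable-stable (x ≟ y) λ x≢y →
      ^-≢0 p (λ e → x≢y (sub-≡0 e)) (trans (frobenius-sub x y) (trans (cong (_- y ^ p) e) (-‿inverseʳ _)))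

    ^-swap : ∀ x m n → (x ^ m) ^ n ≡ (x ^ n) ^ m
    ^-swap x m n = trans (^-assocʳ x m n) (trans (cong (x ^_) (ℕ.*-comm m n)) (sym (^-assocʳ x n m)))

    IsRoot : Carrier → Set
    IsRoot t = t ^ h ≡ 1#

    root-* : ∀ {s t} → IsRoot s → IsRoot t → IsRoot (s * t)
    root-* {s} {t} es et = trans (^-distrib-* s t h) (trans (cong₂ _*_ es et) (*-identityˡ 1#))

    root-^ : ∀ {t} n → IsRoot t → IsRoot (t ^ n)
    root-^ {t} n e = trans (^-swap t n h) (trans (cong (_^ n) e) (1^ n))

    -- Removing one summand at a time, instead of quantifying over n-tuples, makes membership
    -- decidable by a search over K for each summand.
    S : ℕ → Carrier → Set
    S zero    x = x ≡ 0#
    S (suc n) x = ∃ λ t → IsRoot t × S n (x - t)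

    any? : ∀ {ℓ} {P : Carrier → Set ℓ} → Decidable P → Dec (∃ P)
    any? P? = map′ (λ a → let (x , _ , px) = find a in x , px) (λ (x , px) → lose (complete x) px)
                   (Any.any? P? elements)

    S? : ∀ n → Decidable (S n)
    S? zero    x = x ≟ 0#
    S? (suc n) x = any? λ t → (t ^ h ≟ 1#) ×-dec S? n (x - t)

    S-cons : ∀ {n t x} → IsRoot t → S n x → S (suc n) (x + t)
    S-cons {n} {t} {x} et s = t , et , subst (S n) (solve 2 (λ x t → x := (x :+ t) :- t) refl x t) s

    S-+ : ∀ m {n x y} → S m x → S n y → S (m ℕ.+ n) (x + y)
    S-+ zero {n} refl s′ = subst (S n) (sym (+-identityˡ _)) s′
    S-+ (suc m) {n} {x} {y} (t , et , s) s′ = t , et ,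
      subst (S (m ℕ.+ n)) (solve 3 (λ x y t → (x :- t) :+ y := (x :+ y) :- t) refl x y t) (S-+ m s s′)

    S-scale : ∀ n {t x} → IsRoot t → S n x → S n (t * x)
    S-scale zero et refl = zeroʳ _
    S-scale (suc n) {t} {x} et (s , es , sn) = t * s , root-* et es ,
      subst (S n) (solve 3 (λ t x s → t :* (x :- s) := t :* x :- t :* s) refl t x s) (S-scale n et sn)

    S-frobenius : ∀ n {x} → S n x → S n (x ^ p)
    S-frobenius zero refl = 0^p
    S-frobenius (suc n) {x} (t , et , s) = t ^ p , root-^ p et , subst (S n) (frobenius-sub x t) (S-frobenius n s)

    S-one : ∀ n → S n (n · 1#)
    S-one zero = refl
    S-one (suc n) = subst (S (suc n)) (+-comm _ _) (S-cons {n} (1^ h) (S-one n))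

    -- The quotient y / x is an h-th root of unity. Hence the nonzero part of `S n` is a union of
    -- whole cosets.
    S-invariant : ∀ n {x y} → x ≢ 0# → y ^ h ≡ x ^ h → S n x → S n y
    S-invariant n {x} {y} x≢0 e s with invert x x≢0
    ... | i , xi = subst (S n) yix (S-scale n {y * i} yi s)
      where
      yi : IsRoot (y * i)
      yi = trans (^-distrib-* y i h) (trans (cong (_* i ^ h) e)
             (trans (sym (^-distrib-* x i h)) (trans (cong (_^ h) xi) (1^ h))))
      yix : y * i * x ≡ y
      yix = trans (*-assoc y i x) (trans (cong (y *_) (trans (*-comm i x) xi)) (*-identityʳ y))

    -- Cosets of the group of h-th roots of unity are named by their common h-th power.
    InC : ℕ → Carrier → Set
    InC n z = ∃ λ y → y ≢ 0# × S n y × y ^ h ≡ z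

    InC? : ∀ n → Decidable (InC n)
    InC? n z = any? λ y → ¬? (y ≟ 0#) ×-dec (S? n y ×-dec (y ^ h ≟ z))

    C : ℕ → List Carrier
    C n = filter (InC? n) elements

    C-unique : ∀ n → Unique (C n)
    C-unique n = filter⁺ (InC? n) elements-unique

    ∈C⁺ : ∀ n {z} → InC n z → z ∈ C n
    ∈C⁺ n = ∈-filter⁺ (InC? n) (complete _)

    ∈C⁻ : ∀ n {z} → z ∈ C n → InC n z
    ∈C⁻ n z∈ = proj₂ (∈-filter⁻ (InC? n) {xs = elements} z∈)

    C-root : ∀ n {z} → InC n z → z ^ d ≡ 1#
    C-root n (y , y≢0 , _ , refl) = trans (^-assocʳ y h d) (order y y≢0)

    C-≢0 : ∀ n {z} → InC n z → z ≢ 0#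
    C-≢0 n (y , y≢0 , _ , refl) = ^-≢0 h y≢0

    C-frobenius : ∀ n {z} → InC n z → InC n (z ^ p)
    C-frobenius n (y , y≢0 , s , refl) = y ^ p , ^-≢0 p y≢0 , S-frobenius n s , ^-swap y p h

    -- a chosen h-th root; junk value 0 if there is none
    root : Carrier → Carrier
    root z with any? (λ y → y ^ h ≟ z)
    ... | yes (y , _) = y
    ... | no _        = 0#

    root-correct : ∀ {y} → root (y ^ h) ^ h ≡ y ^ h
    root-correct {y} with any? (λ y′ → y′ ^ h ≟ y ^ h)
    ... | yes (_ , e) = e
    ... | no ¬e       = contradiction (y , refl) ¬e

    private
      power-≢0 : ∀ {x y} → y ≢ 0# → x ^ h ≡ y ^ h → x ≢ 0#
      power-≢0 y≢0 e refl = ^-≢0 h y≢0 (trans (sym e) (0^ h h≥1))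

    Full : ℕ → Set
    Full n = ∀ y → y ≢ 0# → S n y

    module _ (n : ℕ) (stuck : length (C (suc n)) ≤ length (C n)) where

      private
        As Bs Bs₀ : List Carrier
        As = filter (S? n) elements
        Bs = filter (S? (suc n)) elements
        Bs₀ = filter (λ y → ¬? (y ≟ 0#)) Bs

        -- Multiplication by `root z / root (y ^ h)` carries the coset named `y ^ h` onto the coset
        -- named `z` in the same position of the other list. The quotient is cleared of its
        -- denominator.
        Transfer : Carrier → Carrier → Set
        Transfer y y′ = ∃ λ z → Matched (C (suc n)) (C n) (y ^ h) z × y′ * root (y ^ h) ≡ y * root z

        transfer-power : ∀ {y y′} → y ≢ 0# → (t : Transfer y y′) → y′ ^ h ≡ proj₁ t
        transfer-power {y} {y′} y≢0 (z , m , e) with ∈C⁻ n (matched-∈ʳ m)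
        ... | w , _ , _ , refl = cancelˡ (^-≢0 h y≢0) (trans (*-comm _ _) (trans (cong (y′ ^ h *_) (sym root-correct))
              (trans (sym (^-distrib-* y′ _ h)) (trans (cong (_^ h) e) (trans (^-distrib-* y _ h)
                (cong (y ^ h *_) root-correct))))))

        transfer-total : ∀ {y} → y ∈ Bs₀ → ∃ λ y′ → y′ ∈ As × Transfer y y′
        transfer-total {y} y∈ with ∈-filter⁻ (λ y → ¬? (y ≟ 0#)) {xs = Bs} y∈
        ... | y∈Bs , y≢0 with ∈-filter⁻ (S? (suc n)) {xs = elements} y∈Bs
        ... | _ , s with matched-total stuck (∈C⁺ (suc n) (y , y≢0 , s , refl))
        ... | z , m with ∈C⁻ n (matched-∈ʳ m) | invert (root (y ^ h)) (power-≢0 y≢0 root-correct)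
        ... | w , w≢0 , sw , refl | i , ri = y′ , ∈-filter⁺ (S? n) (complete y′) (S-invariant n w≢0 (transfer-power y≢0 tr) sw) , tr
          where
          y′ = y * root (w ^ h) * i
          tr : Transfer y y′
          tr = w ^ h , m , trans (*-assoc _ i _) (trans (cong (y * root (w ^ h) *_) (trans (*-comm i _) ri)) (*-identityʳ _))

        nonzero : ∀ {y} → y ∈ Bs₀ → y ≢ 0#
        nonzero y∈ = proj₂ (∈-filter⁻ (λ y → ¬? (y ≟ 0#)) {xs = Bs} y∈)

        transfer-injective : ∀ {x y y′} → x ∈ Bs₀ → y ∈ Bs₀ → Transfer x y′ → Transfer y y′ → x ≡ y
        transfer-injective {x} {y} {y′} x∈ y∈ tx@(z , m , e) ty@(z₁ , m₁ , e₁)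
          with trans (sym (transfer-power (nonzero x∈) tx)) (transfer-power (nonzero y∈) ty)
        ... | refl with ∈C⁻ n (matched-∈ʳ m)
        ... | w , w≢0 , _ , refl = cancelˡ {root (w ^ h)} (power-≢0 w≢0 root-correct)
              (trans (*-comm _ x) (trans (sym e) (trans (cong (λ q → y′ * root q) same)
                (trans e₁ (*-comm y _)))))
          where
          same : x ^ h ≡ y ^ h
          same = matched-injective (C-unique n) m m₁

        Bs₀-≤ : length Bs₀ ≤ length As
        Bs₀-≤ = length-injective Transfer
          (filter⁺ (λ y → ¬? (y ≟ 0#)) (filter⁺ (S? (suc n)) elements-unique)) transfer-total transfer-injective

        Bs-≤ : length Bs ≤ suc (length Bs₀)
        Bs-≤ = length-⊆ {ys = 0# ∷ Bs₀} (filter⁺ (S? (suc n)) elements-unique) sub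
          where
          sub : ∀ {y} → y ∈ Bs → y ∈ 0# ∷ Bs₀
          sub {y} y∈ with y ≟ 0#
          ... | yes y≡0 = here y≡0
          ... | no y≢0  = there (∈-filter⁺ (λ y → ¬? (y ≟ 0#)) y∈ y≢0)

      -- Translation by t embeds S n into S (suc n), which has at most one more element.
      exception-unique : ∀ {t x y} → IsRoot t → S (suc n) x → S (suc n) y →
        ¬ S n (x - t) → ¬ S n (y - t) → x ≡ y
      exception-unique {t} {x} {y} et sx sy ¬sx ¬sy = decidable-stable (x ≟ y) λ x≢y →
        ℕ.1+n≰n (ℕ.≤-trans (ℕ.≤-trans (ℕ.≤-reflexive (cong (2 ℕ.+_) (sym (length-map (_+ t) As))))
          (length-⊆ (unique x≢y) sub)) (ℕ.≤-trans Bs-≤ (s≤s Bs₀-≤)))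
        where
        shift : ∀ {z} → ¬ S n (z - t) → z ∉ map (_+ t) As
        shift ¬s z∈ with ∈-map⁻ (_+ t) z∈
        ... | a , a∈ , refl = ¬s (subst (S n) (solve 2 (λ a t → a := (a :+ t) :- t) refl a t)
                (proj₂ (∈-filter⁻ (S? n) {xs = elements} a∈)))
        unique : x ≢ y → Unique (x ∷ y ∷ map (_+ t) As)
        unique x≢y = ∷-unique (λ { (here e) → x≢y e ; (there x∈) → shift ¬sx x∈ })
          (∷-unique (shift ¬sy) (map⁺ (+-cancelʳ t) (filter⁺ (S? n) elements-unique)))
        sub : ∀ {z} → z ∈ x ∷ y ∷ map (_+ t) As → z ∈ Bs
        sub (here refl) = ∈-filter⁺ (S? (suc n)) (complete _) sx
        sub (there (here refl)) = ∈-filter⁺ (S? (suc n)) (complete _) sy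
        sub (there (there z∈)) with ∈-map⁻ (_+ t) z∈
        ... | a , a∈ , refl = ∈-filter⁺ (S? (suc n)) (complete _)
                (S-cons {n} et (proj₂ (∈-filter⁻ (S? n) {xs = elements} a∈)))

    -- The differences of roots of unity span the ideal generated by ζ - 1, which is everything.
    closed-under-differences : (P : Carrier → Set) → ∀ {x₀} → P x₀ →
      (∀ {x s t} → IsRoot s → IsRoot t → P x → P (x + s - t)) → ∀ y → P y
    closed-under-differences P {x₀} px₀ closed y with invert (ζ - 1#) (λ e → ζ≢1 (sub-≡0 e))
    ... | v , ev = subst P reach (along (span ((y - x₀) * v)))
      where
      along : ∀ {w} → Span ζ w → P (x₀ + w * (ζ - 1#))
      along [] = subst P (sym (trans (cong (x₀ +_) (zeroˡ _)) (+-identityʳ x₀))) px₀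
      along (_∷_ i {w} sp) = subst P
        (trans (solve 5 (λ x w z a o → x :+ w :* (z :- o) :+ z :* a :- a := x :+ (w :* (z :- o) :+ a :* z :- a))
                  refl x₀ w ζ (ζ ^ i) 1#)
          (cong (x₀ +_) (trans (cong (λ e → w * (ζ - 1#) + ζ ^ i * ζ - e) (sym (*-identityʳ (ζ ^ i))))
            (solve 4 (λ w z a o → w :* (z :- o) :+ a :* z :- a :* o := (a :+ w) :* (z :- o)) refl w ζ (ζ ^ i) 1#))))
        (closed (root-^ (suc i) ζ^h≡1) (root-^ i ζ^h≡1) (along sp))
      reach : x₀ + (y - x₀) * v * (ζ - 1#) ≡ y
      reach = trans (cong (x₀ +_) (trans (*-assoc _ v _) (trans (cong ((y - x₀) *_) (trans (*-comm v _) ev)) (*-identityʳ _))))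
        (solve 2 (λ x y → x :+ (y :- x) := y) refl x₀ y)

    -- A search looks for `a` in `S n` and roots `t`, `s` with a + t - s outside `S n`. If there are
    -- none, `S n` itself is closed under adding differences. If there is one, a + t - s turns out
    -- to be 0, and it is `S n` with 0 adjoined that is closed.
    growth : ∀ n → length (C (suc n)) ≤ length (C n) → Full n
    growth n stuck with any? (λ a → any? (λ t → any? (λ s →
        S? n a ×-dec ((t ^ h ≟ 1#) ×-dec ((s ^ h ≟ 1#) ×-dec ¬? (S? n (a + t - s)))))))
    ... | no none = λ y _ → closed-under-differences (S n) (S-one n)
            (λ {x} {s} {t} es et sx → decidable-stable (S? n (x + s - t)) λ ¬s → none (x , s , t , sx , es , et , ¬s)) y
    ... | yes (a , t , s , sa , et , es , ¬u) = λ y y≢0 → [ (λ e → contradiction e y≢0) , (λ q → q) ]′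
            (closed-under-differences (λ x → x ≡ 0# ⊎ S n x) (inj₁ refl) closed y)
      where
      u = a + t - s

      -- The roots 1, ζ, ζ² are distinct, and r has to avoid only 1 and t / s; so ζ or ζ² will do.
      third : ∃ λ r → IsRoot r × r ≢ 1# × r * s ≢ t
      third with ζ * s ≟ t
      ... | no q = ζ , ζ^h≡1 , ζ≢1 , q
      ... | yes refl = ζ ^ 2 , root-^ 2 ζ^h≡1 , ζ²≢ζ⁰ , λ e → ζ≢1 (cancelˡ (unit-≢0 h h≥1 ζ^h≡1)
            (trans (trans (cong (ζ *_) (sym (*-identityʳ ζ))) (cancelˡ (unit-≢0 h h≥1 es)
              (trans (*-comm s _) (trans e (*-comm ζ s))))) (sym (*-identityʳ ζ))))

      -- Both x + t and r (a + t), where x = a + r s - s, are exceptional for r s.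
      u≡0 : u ≡ 0#
      u≡0 with third
      ... | r , er , r≢1 , rs≢t = decidable-stable (u ≟ 0#) λ u≢0 → r≢1
            (cancelˡ u≢0 (trans (*-comm u r) (trans (sym same) (sym (*-identityʳ u)))))
        where
        -- Otherwise a + r s and a + t would both be exceptional for translation by s, forcing r s =
        -- t.
        sx : S n (a + r * s - s)
        sx = decidable-stable (S? n _) λ ¬sx → rs≢t (+-cancelʳ a (trans (+-comm _ a) (trans
               (exception-unique n stuck es (S-cons {n} (root-* er es) sa) (S-cons {n} et sa) ¬sx ¬u) (+-comm a t))))
        ¬ru : ¬ S n (r * u)
        ¬ru sru = ¬u (S-invariant n (λ e → ¬u (subst (S n) (trans e (sym (u0 e))) sru))
                   (sym (trans (^-distrib-* r u h) (trans (cong (_* u ^ h) er) (*-identityˡ _)))) sru)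
          where u0 : r * u ≡ 0# → u ≡ 0#
                u0 e = cancelˡ (unit-≢0 h h≥1 er) (trans e (sym (zeroʳ r)))
        same : u ≡ r * u
        same = trans (solve 4 (λ a t s r → a :+ t :- s := (a :+ r :* s :- s) :+ t :- r :* s) refl a t s r)
          (trans (cong (_- r * s) (exception-unique n stuck (root-* er es) (S-cons {n} et sx)
              (S-scale (suc n) er (S-cons {n} et sa))
              (λ q → ¬u (subst (S n) (solve 4 (λ a t s r → (a :+ r :* s :- s) :+ t :- r :* s := a :+ t :- s) refl a t s r) q))
              (λ q → ¬ru (subst (S n) (solve 4 (λ a t s r → r :* (a :+ t) :- r :* s := r :* (a :+ t :- s)) refl a t s r) q))))
            (solve 4 (λ a t s r → r :* (a :+ t) :- r :* s := r :* (a :+ t :- s)) refl a t s r))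

      ¬S0 : ¬ S n 0#
      ¬S0 q = ¬u (subst (S n) (sym u≡0) q)

      -- u = 0 says a + t = s, so `S (suc n)` contains one root and with it all of them. As 0 is not
      -- in `S n`, each root `t′` is the exceptional element of its own translation.
      roots∈ : ∀ {t′} → IsRoot t′ → S (suc n) t′
      roots∈ et′ = S-invariant (suc n) (unit-≢0 h h≥1 es) (trans et′ (sym es))
        (subst (S (suc n)) (sub-≡0 u≡0) (S-cons {n} et sa))

      ¬S[t-t] : ∀ t′ → ¬ S n (t′ - t′)
      ¬S[t-t] t′ q = ¬S0 (subst (S n) (-‿inverseʳ t′) q)

      closed : ∀ {x s′ t′} → IsRoot s′ → IsRoot t′ → x ≡ 0# ⊎ S n x → x + s′ - t′ ≡ 0# ⊎ S n (x + s′ - t′)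
      closed {x} {s′} {t′} es′ et′ sx with S? n (x + s′ - t′)
      ... | yes q = inj₂ q
      ... | no ¬q = inj₁ (trans (cong (_- t′) (exception-unique n stuck et′ (sum sx) (roots∈ et′) ¬q (¬S[t-t] t′))) (-‿inverseʳ t′))
        where
        sum : x ≡ 0# ⊎ S n x → S (suc n) (x + s′)
        sum (inj₁ refl) = subst (S (suc n)) (sym (+-identityˡ s′)) (roots∈ es′)
        sum (inj₂ q) = S-cons {n} es′ q

    -- One more summand also reaches 0, which `Full` leaves out. The last summand can be 1 or ζ, and
    -- y minus it is nonzero for at least one choice.
    full-suc : ∀ n → Full n → ∀ y → S (suc n) y
    full-suc n full y with y ≟ 1#
    ... | no y≢1 = 1# , 1^ h , full (y - 1#) (λ e → y≢1 (sub-≡0 e))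
    ... | yes refl = ζ , ζ^h≡1 , full (1# - ζ) (λ e → ζ≢1 (sym (sub-≡0 e)))

    full-+ : ∀ k n → Full n → ∀ y → S (k ℕ.+ suc n) y
    full-+ zero n full = full-suc n full
    full-+ (suc k) n full = full-suc (k ℕ.+ suc n) (λ y _ → full-+ k n full y)

    full-< : ∀ {m n} → m < n → Full m → S n 0#
    full-< {m} {n} m<n full = subst (λ k → S k 0#) (ℕ.m∸n+n≡m m<n) (full-+ (n ∸ suc m) m full 0#)

    climb : ∀ {m} n k → m ≤ length (C n) → k ℕ.+ m ≤ length (C (k ℕ.+ n)) ⊎ Full (k ℕ.+ n)
    climb n zero le = inj₁ le
    climb {m} n (suc k) le with climb n k le
    ... | inj₂ full = inj₂ (λ y _ → full-suc (k ℕ.+ n) full y)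
    ... | inj₁ le′ with length (C (suc k ℕ.+ n)) ℕ.≤? length (C (k ℕ.+ n))
    ...   | yes stuck = inj₂ (λ y _ → full-suc (k ℕ.+ n) (growth (k ℕ.+ n) stuck) y)
    ...   | no ¬stuck = inj₁ (ℕ.≤-trans (s≤s le′) (ℕ.≰⇒> ¬stuck))

    roots-≤d : ∀ {L} n → Unique L → (∀ {z} → z ∈ L → InC n z) → length L ≤ d
    roots-≤d n u sub = roots-of-unity-bound d d≥1 u (λ z∈ → C-root n (sub z∈))

    -- Names of cosets are d-th roots of unity. A coset outside `S n` would bring their number to d
    -- + 1.
    saturated : ∀ n → d ≤ length (C n) → Full n
    saturated n d≤ y y≢0 = decidable-stable (S? n y) λ ¬s →
      ℕ.1+n≰n (ℕ.≤-trans (s≤s d≤) (roots-of-unity-bound d d≥1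
        (∷-unique (λ yh∈ → let (w , w≢0 , sw , e) = ∈C⁻ n yh∈ in ¬s (S-invariant n w≢0 (sym e) sw)) (C-unique n))
        λ { (here refl) → trans (^-assocʳ y h d) (order y y≢0) ; (there z∈) → C-root n (∈C⁻ n z∈) }))

    zero-sum : ∀ n → d < n → S n 0#
    zero-sum n d<n with climb 0 d (z≤n {length (C 0)})
    ... | inj₁ le = full-< d<n (saturated d (subst₂ _≤_ (ℕ.+-identityʳ d) (cong (λ k → length (C k)) (ℕ.+-identityʳ d)) le))
    ... | inj₂ full = full-< d<n (subst Full (ℕ.+-identityʳ d) full)

    cube-root-sum : ζ ^ 3 ≡ 1# → S 3 0#
    cube-root-sum e = subst (S 3) sum≡0
      (S-cons {2} (root-^ 2 ζ^h≡1) (S-cons {1} ζ^h≡1 (1# , 1^ h , -‿inverseʳ 1#)))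
      where
      sum≡0 : 1# + ζ + ζ ^ 2 ≡ 0#
      sum≡0 = cancelˡ {ζ - 1#} (λ q → ζ≢1 (sub-≡0 q)) (trans
        (trans (solve 2 (λ z o → (z :- o) :* (o :+ z :+ z :* (z :* o)) :=
                          z :* (z :* (z :* o)) :+ (z :* z :- z :* z :* (o :* o)) :- o :* o) refl ζ 1#)
          (cong₂ _-_ (trans (cong₂ (λ u v → u + (ζ * ζ - v)) e
              (trans (cong (ζ * ζ *_) (*-identityˡ 1#)) (*-identityʳ _)))
            (trans (cong (1# +_) (-‿inverseʳ _)) (+-identityʳ 1#))) (*-identityˡ 1#)))
        (trans (-‿inverseʳ 1#) (sym (zeroʳ _))))

    S-multiple : ∀ n k → S n 0# → S (k ℕ.* n) 0#
    S-multiple n zero s = refl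
    S-multiple n (suc k) s = subst (S (n ℕ.+ k ℕ.* n)) (+-identityˡ 0#) (S-+ n s (S-multiple n k s))

    -- The extremal case: 0 is not a sum of d roots of unity.

    module _ (¬Sd : ¬ S d 0#) where

      -- With n + 1 cosets in `S n` the growth is one step ahead: all d cosets are reached in
      -- `S (d ∸ 1)` at the latest, and one more summand reaches 0.
      C-≤ : ∀ n L → Unique L → (∀ {z} → z ∈ L → InC n z) → length L ≤ n
      C-≤ n L u sub = ℕ.≮⇒≥ λ n<L → ¬Sd (full n<L)
        where
        full : n < length L → S d 0#
        full n<L with climb n (d ∸ suc n) (ℕ.≤-trans n<L (length-⊆ u (λ z∈ → ∈C⁺ n (sub z∈))))
                    | ℕ.≤-trans n<L (roots-≤d n u sub)
        ... | inj₁ le | n<d = full-< k<d (saturated _ (subst (_≤ length (C (d ∸ suc n ℕ.+ n))) (ℕ.m∸n+n≡m n<d) le))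
          where k<d = ℕ.≤-reflexive (trans (sym (ℕ.+-suc (d ∸ suc n) n)) (ℕ.m∸n+n≡m n<d))
        ... | inj₂ f  | n<d = full-< (ℕ.≤-reflexive (trans (sym (ℕ.+-suc (d ∸ suc n) n)) (ℕ.m∸n+n≡m n<d))) f

      C-≥ : ∀ n → n < d → n ≤ length (C n)
      C-≥ n n<d with climb 0 n (z≤n {length (C 0)})
      ... | inj₂ full = contradiction (full-< n<d (subst Full (ℕ.+-identityʳ n) full)) ¬Sd
      ... | inj₁ le = subst₂ _≤_ (ℕ.+-identityʳ n) (cong (λ k → length (C k)) (ℕ.+-identityʳ n)) le

      C-missing : ∀ n L → n < d → length L < n → ∃ λ z → InC n z × z ∉ L
      C-missing n L n<d L<n with missing _≟_ (C-unique n) (ℕ.≤-trans L<n (C-≥ n n<d))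
      ... | z , z∈ , z∉ = z , ∈C⁻ n z∈ , z∉

      -- Frobenius fixes only the name 1, so a second coset in `S 2` has an orbit {z, z²}, made of
      -- cube roots of unity. Since 1 + 1 = 0, this orbit persists in `S 4`. The four cosets there
      -- include some z′ that is not a cube root of unity; its orbit has at least three members,
      -- which makes five.
      characteristic-two : p ≡ 2 → ¬ (4 < d)
      characteristic-two p≡2 4<d with C-missing 2 (1# ∷ []) (ℕ.<-trans (s≤s (s≤s (s≤s z≤n))) 4<d) (s≤s (s≤s z≤n))
      ... | z , z∈ , z∉ with C-missing 4 (1# ∷ z ∷ z ^ p ∷ []) 4<d (s≤s (s≤s (s≤s (s≤s z≤n))))
      ... | z′ , z′∈ , z′∉ = ℕ.1+n≰n (C-≤ 4 (z′ ∷ z′ ^ p ∷ (z′ ^ p) ^ p ∷ z ∷ z ^ p ∷ []) unique₅ λ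
              { (here refl) → z′∈
              ; (there (here refl)) → C-frobenius 4 z′∈
              ; (there (there (here refl))) → C-frobenius 4 (C-frobenius 4 z′∈)
              ; (there (there (there (here refl)))) → two+two z∈
              ; (there (there (there (there (here refl))))) → two+two (C-frobenius 2 z∈) })
        where
        fixed⇒1 : ∀ {x} → x ≢ 0# → x ^ p ≡ x → x ≡ 1#
        fixed⇒1 {x} x≢0 e = trans (sym (*-identityʳ x)) (cancelˡ x≢0
          (trans (trans (cong (x ^_) (sym p≡2)) e) (sym (*-identityʳ x))))
        two+two : ∀ {x} → InC 2 x → InC 4 x
        two+two (y , y≢0 , s , e) = y , y≢0 , subst (S 4) (+-identityˡ y)
          (S-+ 2 (subst (λ k → S k 0#) p≡2 (subst (S p) char (S-one p))) s) , e
        z₂≢z : z ^ p ≢ z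
        z₂≢z e = z∉ (here (fixed⇒1 (C-≢0 2 z∈) e))
        cubic : ∀ {x} → x ≢ 0# → (x ^ p) ^ p ≡ x → x ^ 3 ≡ 1#
        cubic {x} x≢0 e = trans (cong (λ q → x ^ (q ℕ.* q ∸ 1)) (sym p≡2))
          (pred (p ℕ.* p) (subst (λ q → 1 ≤ q ℕ.* q) (sym p≡2) (s≤s z≤n)) x≢0 (trans (sym (^-assocʳ x p p)) e))
        z₄≡z : (z ^ p) ^ p ≡ z
        z₄≡z = decidable-stable (_ ≟ z) λ z₄≢z → ℕ.1+n≰n (C-≤ 2 (z ∷ z ^ p ∷ (z ^ p) ^ p ∷ [])
          (∷-unique (λ { (here e) → z₂≢z (sym e) ; (there (here e)) → z₄≢z (sym e) })
            (∷-unique (λ { (here e) → z₂≢z (sym (frobenius-injective e)) }) (∷-unique (λ ()) [])))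
          λ { (here refl) → z∈ ; (there (here refl)) → C-frobenius 2 z∈
            ; (there (there (here refl))) → C-frobenius 2 (C-frobenius 2 z∈) })
        z′₂≢z′ : z′ ^ p ≢ z′
        z′₂≢z′ e = z′∉ (here (fixed⇒1 (C-≢0 4 z′∈) e))
        z′₂≢z : z′ ^ p ≢ z
        z′₂≢z e = z′∉ (there (there (here (frobenius-injective (trans e (sym z₄≡z))))))
        z′₂≢z₂ : z′ ^ p ≢ z ^ p
        z′₂≢z₂ e = z′∉ (there (here (frobenius-injective e)))
        z′₄≢z′ : (z′ ^ p) ^ p ≢ z′
        z′₄≢z′ e = ℕ.1+n≰n (roots-of-unity-bound 3 (s≤s z≤n) {z′ ∷ 1# ∷ z ∷ z ^ p ∷ []}
          (∷-unique z′∉ (∷-unique (λ { (here e) → z∉ (here (sym e))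
                                     ; (there (here e)) → z∉ (here (frobenius-injective (trans (sym e) (sym (1^ p))))) })
            (∷-unique (λ { (here e) → z₂≢z (sym e) }) (∷-unique (λ ()) []))))
          λ { (here refl) → cubic (C-≢0 4 z′∈) e
            ; (there (here refl)) → 1^ 3
            ; (there (there (here refl))) → cubic (C-≢0 2 z∈) z₄≡z
            ; (there (there (there (here refl)))) → cubic (C-≢0 2 (C-frobenius 2 z∈)) (cong (_^ p) z₄≡z) })
        unique₅ : Unique (z′ ∷ z′ ^ p ∷ (z′ ^ p) ^ p ∷ z ∷ z ^ p ∷ [])
        unique₅ = ∷-unique (λ { (here e) → z′₂≢z′ (sym e) ; (there (here e)) → z′₄≢z′ (sym e)
                              ; (there (there z∈)) → z′∉ (there z∈) })
          (∷-unique (λ { (here e) → z′₂≢z′ (sym (frobenius-injective e)) ; (there (here e)) → z′₂≢z e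
                       ; (there (there (here e))) → z′₂≢z₂ e })
          (∷-unique (λ { (here e) → z′₂≢z₂ (frobenius-injective (trans e (sym z₄≡z)))
                       ; (there (here e)) → z′₂≢z (frobenius-injective e) })
          (∷-unique (λ { (here e) → z₂≢z (sym e) }) (∷-unique (λ ()) []))))

      -- Odd characteristic: counting Frobenius orbits of cosets.

      module Odd (p≥3 : 3 ≤ p) (2[p-1]≤d : 2 ℕ.* (p ∸ 1) ≤ d)
          {b₁ k₁ : ℕ} (inv₁ : h ℕ.* b₁ ≡ 1 ℕ.+ (p ∸ 1) ℕ.* k₁) where

        private
          p≥1 : 1 ≤ p
          p≥1 = ℕ.≤-trans (s≤s z≤n) p≥3

          p-1≥2 : 2 ≤ p ∸ 1
          p-1≥2 = ℕ.∸-monoˡ-≤ 1 p≥3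

        p<d : p < d
        p<d = ℕ.≤-trans (ℕ.≤-trans (ℕ.≤-reflexive (cong suc (sym (ℕ.m+[n∸m]≡n p≥1))))
          (ℕ.+-mono-≤ p-1≥2 (ℕ.≤-reflexive (sym (ℕ.+-identityʳ (p ∸ 1)))))) 2[p-1]≤d

        small-≢0 : ∀ {m} → 1 ≤ m → m < p → m · 1# ≢ 0#
        small-≢0 {suc m} m≥1 m<p = multiple-≢0 (Coprimality.sym (prime⇒coprime p-prime m<p)) m≥1 char

        2≢0 : 1# + 1# ≢ 0#
        2≢0 e = small-≢0 {2} (s≤s z≤n) p≥3 (trans (cong (1# +_) (+-identityʳ 1#)) e)

        double-≢0 : ∀ {x} → x ≢ 0# → x + x ≢ 0#
        double-≢0 {x} x≢0 e = product-≢0 x≢0 2≢0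
          (trans (distribˡ x 1# 1#) (trans (cong₂ _+_ (*-identityʳ x) (*-identityʳ x)) e))

        2^p : (1# + 1#) ^ p ≡ 1# + 1#
        2^p = trans (frobenius-+ 1# 1#) (cong₂ _+_ (1^ p) (1^ p))

        S-two : S 2 (1# + 1#)
        S-two = subst (S 2) (cong (1# +_) (+-identityʳ 1#)) (S-one 2)

        C-two : InC 2 ((1# + 1#) ^ h)
        C-two = 1# + 1# , 2≢0 , S-two , refl

        -- `h` is prime to p - 1. Counting nonzero elements of the prime field therefore counts
        -- cosets.
        fixed-powers-injective : ∀ {x y} → x ≢ 0# → y ≢ 0# → x ^ p ≡ x → y ^ p ≡ y → x ^ h ≡ y ^ h → x ≡ y
        fixed-powers-injective x≢0 y≢0 fx fy e = trans (sym (root-power {h} {p ∸ 1} {b₁} {k₁} inv₁ (pred p p≥1 x≢0 fx)))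
          (trans (cong (_^ b₁) e) (root-power {h} {p ∸ 1} {b₁} {k₁} inv₁ (pred p p≥1 y≢0 fy)))

        -- The coset of 1 + 1 is fixed, and beside it `S 2` has room for one coset only, too little
        -- for an orbit of length two or more.
        fixed-C₂ : ∀ {z} → InC 2 z → z ^ p ≡ z
        fixed-C₂ {z} z∈ = decidable-stable (z ^ p ≟ z) λ z₁≢z → ℕ.1+n≰n (C-≤ 2 (2^h ∷ z ∷ z ^ p ∷ [])
          (∷-unique (λ { (here e) → z₁≢z (trans (cong (_^ p) (sym e)) (trans fixed e))
                       ; (there (here e)) → z₁≢z (sym (trans (frobenius-injective (trans (sym e) (sym fixed))) e)) })
            (∷-unique (λ { (here e) → z₁≢z (sym e) }) (∷-unique (λ ()) [])))
          λ { (here refl) → C-two ; (there (here refl)) → z∈ ; (there (there (here refl))) → C-frobenius 2 z∈ })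
          where
          2^h = (1# + 1#) ^ h
          fixed : 2^h ^ p ≡ 2^h
          fixed = trans (^-swap _ h p) (cong (_^ h) 2^p)

        -- If x^(p+1) = 1 for every h-th root of unity x, then x + x⁻¹ = x + x^p lies in the prime field.
        quadratic : (∀ {x} → IsRoot x → x ^ suc p ≡ 1#) → ζ ^ 3 ≢ 1# → ⊥
        quadratic norm ζ³≢1 = ℕ.1+n≰n (C-≤ 2 ((1# + 1#) ^ h ∷ (a + b) ^ h ∷ (a ^ 2 + b ^ 2) ^ h ∷ [])
          (∷-unique (λ { (here e) → ζ≢1 (trace≢2 ab (sym (inj 2≢0 (trace≢0 ab ra a≢1) 2^p (trace-fixed ra) e)))
                       ; (there (here e)) → ζ²≢ζ⁰ (trace≢2 a²b² (sym (inj 2≢0 (trace≢0 a²b² (root-^ 2 ra) ζ²≢ζ⁰) 2^p fixed₂ e))) })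
            (∷-unique (λ { (here e) → traces-differ (inj (trace≢0 ab ra a≢1) (trace≢0 a²b² (root-^ 2 ra) ζ²≢ζ⁰) (trace-fixed ra) fixed₂ e) })
              (∷-unique (λ ()) [])))
          λ { (here refl) → C-two
            ; (there (here refl)) → a + b , trace≢0 ab ra a≢1 , S-pair ra rb , refl
            ; (there (there (here refl))) → a ^ 2 + b ^ 2 , trace≢0 a²b² (root-^ 2 ra) ζ²≢ζ⁰ , S-pair (root-^ 2 ra) (root-^ 2 rb) , refl })
          where
          a = ζ
          b = ζ ^ p
          ra = ζ^h≡1
          rb = root-^ p ζ^h≡1
          a≢1 = ζ≢1
          inj = fixed-powers-injective
          ab : a * b ≡ 1#
          ab = norm ra
          a²b² : a ^ 2 * b ^ 2 ≡ 1#
          a²b² = trans (sym (^-distrib-* a b 2)) (trans (cong (_^ 2) ab) (1^ 2))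
          S-pair : ∀ {x y} → IsRoot x → IsRoot y → S 2 (x + y)
          S-pair {x} {y} rx ry = S-cons {1} ry (x , rx , -‿inverseʳ x)
          trace-fixed : ∀ {x} → IsRoot x → (x + x ^ p) ^ p ≡ x + x ^ p
          trace-fixed {x} rx = trans (frobenius-+ x (x ^ p)) (trans (cong (x ^ p +_) back) (+-comm _ x))
            where
            back : (x ^ p) ^ p ≡ x
            back = cancelˡ {x ^ p} (^-≢0 p (unit-≢0 h h≥1 rx))
              (trans (norm (root-^ p rx)) (trans (sym (norm rx)) (*-comm x _)))
          fixed₂ : (a ^ 2 + b ^ 2) ^ p ≡ a ^ 2 + b ^ 2
          fixed₂ = subst (λ e → (a ^ 2 + e) ^ p ≡ a ^ 2 + e) (^-swap a 2 p) (trace-fixed (root-^ 2 ra))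
          trace≢2 : ∀ {x y} → x * y ≡ 1# → x + y ≡ 1# + 1# → x ≡ 1#
          trace≢2 {x} {y} xy e = decidable-stable (x ≟ 1#) λ x≢1 →
            product-≢0 (λ q → x≢1 (sub-≡0 q)) (λ q → x≢1 (sub-≡0 q))
              (trans (trans (solve 2 (λ x o → (x :- o) :* (x :- o) := x :* x :+ (o :* o :- x :* (o :+ o))) refl x 1#)
              (trans (cong₂ (λ u v → x * x + (u - x * v)) (trans (*-identityˡ 1#) (sym xy)) (sym e))
              (solve 2 (λ x y → x :* x :+ (x :* y :- x :* (x :+ y)) := x :- x) refl x y))) (-‿inverseʳ x))
          -- x + y = 0 and x y = 1 give x² = -1 and x⁴ = 1, so x² = 1 because x² is an h-th root of
          -- unity and `h` is odd. Then 2 = x² + x y = x (x + y) = 0.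
          trace≢0 : ∀ {x y} → x * y ≡ 1# → IsRoot x → x ≢ 1# → x + y ≢ 0#
          trace≢0 {x} {y} xy rx x≢1 e = 2≢0 (trans (cong₂ _+_ (sym x²≡1) (sym xy))
            (trans (sym (distribˡ x x y)) (trans (cong (x *_) e) (zeroʳ x))))
            where
            x²≡-xy : x * x ≡ - (x * y)
            x²≡-xy = trans (solve 2 (λ x y → x :* x := x :* (x :+ y) :- x :* y) refl x y)
              (trans (cong (λ q → x * q - x * y) e) (trans (cong (_- x * y) (zeroʳ x)) (+-identityˡ _)))
            x⁴≡1 : (x ^ 2) ^ 2 ≡ 1#
            x⁴≡1 = trans (cong₂ (λ u v → u * (v * 1#)) sq sq)
              (trans (solve 1 (λ o → (:- o) :* (:- o :* o) := o :* o :* o) refl 1#)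
                (trans (cong (_* 1#) (*-identityˡ 1#)) (*-identityˡ 1#)))
              where sq : x ^ 2 ≡ - 1#
                    sq = trans (cong (x *_) (*-identityʳ x)) (trans x²≡-xy (cong -_ xy))
            x²≡1 : x * x ≡ 1#
            x²≡1 = trans (cong (x *_) (sym (*-identityʳ x))) (square-roots (root-^ 2 rx) x⁴≡1)
          -- As a b = 1, (a - 1)(a - b²) = (a² + b²) - (a + b), and a = b² would give a³ = a² b² =
          -- 1.
          traces-differ : a + b ≢ a ^ 2 + b ^ 2
          traces-differ e = product-≢0 (λ q → a≢1 (sub-≡0 q)) a≢b²
              (trans (solve 3 (λ a b o → (a :- o) :* (a :- b :* b) := (a :* a :+ b :* b :* o) :- (a :* o :+ (a :* b) :* b)) refl a b 1#)
              (trans (cong₂ (λ u v → u - v)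
                  (cong₂ (λ u v → a * u + v) (sym (*-identityʳ a)) (trans (*-identityʳ _) (cong (b *_) (sym (*-identityʳ b)))))
                  (cong₂ _+_ (*-identityʳ a) (trans (cong (_* b) ab) (*-identityˡ b))))
              (trans (cong (_- (a + b)) (sym e)) (-‿inverseʳ _))))
            where
            a≢b² : a - b * b ≢ 0#
            a≢b² q = ζ³≢1 (trans (cong (_* a ^ 2) (sub-≡0 q)) (trans (cong (_* a ^ 2)
              (cong (b *_) (sym (*-identityʳ b)))) (trans (*-comm _ _) a²b²)))

        AllFixed : ℕ → Set
        AllFixed n = ∀ {z} → InC n z → z ^ p ≡ z

        Moved : ℕ → Set
        Moved n = ∃ λ z → InC n z × z ^ p ≢ z

        allFixed? : ∀ n → AllFixed n ⊎ Moved n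
        allFixed? n with any? (λ z → InC? n z ×-dec ¬? (z ^ p ≟ z))
        ... | yes moved = inj₂ moved
        ... | no none   = inj₁ λ {z} z∈ → decidable-stable (z ^ p ≟ z) λ ne → none (z , z∈ , ne)

        -- Fixed names are (p - 1)-st roots of unity, fewer than the p cosets which `S p` has
        -- because p < d.
        moved-p : Moved p
        moved-p with C-missing p units p<d (ℕ.≤-trans (s≤s (roots-of-unity-bound (p ∸ 1) (ℕ.≤-trans (s≤s z≤n) p-1≥2)
            (filter⁺ unit? elements-unique) (λ x∈ → proj₂ (∈-filter⁻ unit? {xs = elements} x∈))))
            (ℕ.≤-reflexive (ℕ.m+[n∸m]≡n p≥1)))
          where
          unit? : Decidable (λ x → x ^ (p ∸ 1) ≡ 1#)
          unit? x = x ^ (p ∸ 1) ≟ 1#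
          units = filter unit? elements
        ... | z , z∈ , z∉ = z , z∈ , λ e → z∉ (∈-filter⁺ (λ x → x ^ (p ∸ 1) ≟ 1#) (complete z) (pred p p≥1 (C-≢0 p z∈) e))

        first-moved : ∀ k m → AllFixed m → Moved (k ℕ.+ m) → ∃ λ n → m ≤ n × n < k ℕ.+ m × AllFixed n × Moved (suc n)
        first-moved zero m fixed (z , z∈ , ne) = contradiction (fixed z∈) ne
        first-moved (suc k) m fixed moved with allFixed? (suc m)
        ... | inj₂ mv = m , ℕ.≤-refl , s≤s (ℕ.m≤n+m m k) , fixed , mv
        ... | inj₁ fixed′ with first-moved k (suc m) fixed′ (subst Moved (sym (ℕ.+-suc k m)) moved)
        ...   | n , m<n , n<k , rest = n , ℕ.<⇒≤ m<n , ℕ.≤-trans n<k (ℕ.≤-reflexive (ℕ.+-suc k m)) , rest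

        module FirstMoved {b₂ k₂ : ℕ} (inv₂ : h ℕ.* b₂ ≡ 1 ℕ.+ (p ℕ.* p ∸ 1) ℕ.* k₂) {n : ℕ} (n≥2 : 2 ≤ n) (n<d : n < d) (fixedₙ : AllFixed n)
            {z : Carrier} (z∈ : InC (suc n) z) (z₁≢z : z ^ p ≢ z) where

          private
            N = suc n

            p²≥1 : 1 ≤ p ℕ.* p
            p²≥1 = ℕ.*-mono-≤ p≥1 p≥1

            Fixed : ℕ → Carrier → Set
            Fixed k x = x ^ p ≡ x × S k x

            fixed? : Decidable (λ x → (x ≢ 0#) × Fixed n x)
            fixed? x = ¬? (x ≟ 0#) ×-dec ((x ^ p ≟ x) ×-dec S? n x)

            X : List Carrier
            X = filter fixed? elements

            ∈X⁻ : ∀ {x} → x ∈ X → (x ≢ 0#) × Fixed n x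
            ∈X⁻ x∈ = proj₂ (∈-filter⁻ fixed? {xs = elements} x∈)

            X-unique : Unique X
            X-unique = filter⁺ fixed? elements-unique

            fixed-root : ∀ {z} → InC n z → (z ^ b₁) ^ h ≡ z
            fixed-root z∈ = power-root {h} {p ∸ 1} {b₁} {k₁} inv₁ (pred p p≥1 (C-≢0 n z∈) (fixedₙ z∈))

            -- All cosets in `S n` are fixed, and the coset named `z` contains the prime-field
            -- element `z ^ b₁`.
            n≤X : n ≤ length X
            n≤X = ℕ.≤-trans (C-≥ n n<d) (length-injective (λ z x → x ≡ z ^ b₁) (C-unique n)
              (λ {z} z∈ → z ^ b₁ , ∈-filter⁺ fixed? (complete _) (member (∈C⁻ n z∈)) , refl)
              (λ {x} {y} x∈ y∈ ex ey → trans (sym (fixed-root (∈C⁻ n x∈))) (trans (cong (_^ h) (trans (sym ex) ey)) (fixed-root (∈C⁻ n y∈)))))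
              where
              member : ∀ {z} → InC n z → (z ^ b₁ ≢ 0#) × Fixed n (z ^ b₁)
              member {z} z∈@(y , y≢0 , s , e) = ^-≢0 b₁ (C-≢0 n z∈)
                , trans (^-swap z b₁ p) (cong (_^ b₁) (fixedₙ z∈))
                , S-invariant n y≢0 (trans (fixed-root z∈) (sym e)) s

            -- A further summand 1 brings X into `S N` and keeps it in the prime field. The price is
            -- that 0 may occur.
            Y : List Carrier
            Y = map (_+ 1#) X

            Y-unique : Unique Y
            Y-unique = map⁺ (+-cancelʳ 1#) X-unique

            n≤Y : n ≤ length Y
            n≤Y = ℕ.≤-trans n≤X (ℕ.≤-reflexive (sym (length-map (_+ 1#) X)))

            ∈Y⁻ : ∀ {y} → y ∈ Y → Fixed N y
            ∈Y⁻ y∈ with ∈-map⁻ (_+ 1#) y∈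
            ... | x , x∈ , refl with ∈X⁻ x∈
            ...   | _ , fx , sx = trans (frobenius-+ x 1#) (cong₂ _+_ fx (1^ p)) , S-cons {n} (1^ h) sx

            -- Elements of `L` give fixed cosets, so these are disjoint from `M`; together they are
            -- cosets in `S N`, of which there are at most N.
            few-fixed : ∀ {L M} → Unique L → (∀ {x} → x ∈ L → (x ≢ 0#) × Fixed N x) →
              Unique M → (∀ {x} → x ∈ M → InC N x × x ^ p ≢ x) → length M ℕ.+ length L ≤ N
            few-fixed {L} {M} uL fL uM mM = ℕ.≤-trans (ℕ.≤-reflexive
                (sym (trans (length-++ M) (cong (length M ℕ.+_) (length-map (_^ h) L)))))
              (C-≤ N (M ++ map (_^ h) L) (++⁺ uM (map-unique
                  (λ x∈ y∈ e → fixed-powers-injective (proj₁ (fL x∈)) (proj₁ (fL y∈)) (proj₁ (proj₂ (fL x∈))) (proj₁ (proj₂ (fL y∈))) e) uL)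
                disjoint) sub)
              where
              disjoint : ∀ {x} → ¬ (x ∈ M × x ∈ map (_^ h) L)
              disjoint (x∈M , x∈) with ∈-map⁻ (_^ h) x∈
              ... | y , y∈ , refl = proj₂ (mM x∈M) (trans (^-swap y h p) (cong (_^ h) (proj₁ (proj₂ (fL y∈)))))
              sub : ∀ {x} → x ∈ M ++ map (_^ h) L → InC N x
              sub x∈ with ∈-++⁻ M x∈
              ... | inj₁ q = proj₁ (mM q)
              ... | inj₂ q with ∈-map⁻ (_^ h) q
              ...   | y , y∈ , refl = y , proj₁ (fL y∈) , proj₂ (proj₂ (fL y∈)) , refl

            pair : List Carrier
            pair = z ∷ z ^ p ∷ []

            pair-unique : Unique pair
            pair-unique = ∷-unique (λ { (here e) → z₁≢z (sym e) }) (∷-unique (λ ()) [])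

            pair-moved : ∀ {x} → x ∈ pair → InC N x × x ^ p ≢ x
            pair-moved (here refl) = z∈ , z₁≢z
            pair-moved (there (here refl)) = C-frobenius N z∈ , λ e → z₁≢z (frobenius-injective e)

          -- Otherwise the n or more elements of `Y` are nonzero and, with the two cosets z and z^p,
          -- give n + 2 cosets in `S (n + 1)`.
          zero∈Y : S N 0#
          zero∈Y = decidable-stable (S? N 0#) λ ¬s → ℕ.1+n≰n (ℕ.≤-trans (ℕ.+-monoʳ-≤ 2 n≤Y)
            (few-fixed Y-unique (λ y∈ → (λ e → ¬s (subst (S N) e (proj₂ (∈Y⁻ y∈)))) , ∈Y⁻ y∈) pair-unique pair-moved))

          private
            Y₀ : List Carrier
            Y₀ = filter (λ y → ¬? (y ≟ 0#)) Y

            Y≤Y₀ : length Y ≤ suc (length Y₀)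
            Y≤Y₀ = length-⊆ {ys = 0# ∷ Y₀} Y-unique sub
              where
              sub : ∀ {y} → y ∈ Y → y ∈ 0# ∷ Y₀
              sub {y} y∈ with y ≟ 0#
              ... | yes e = here e
              ... | no ne = there (∈-filter⁺ (λ y → ¬? (y ≟ 0#)) y∈ ne)

            -- At least n - 1 elements of `Y` are nonzero; a third coset in the orbit of `z` would
            -- again make n + 2.
            period-two : (z ^ p) ^ p ≡ z
            period-two = decidable-stable (_ ≟ z) λ z₂≢z → ℕ.1+n≰n (ℕ.≤-trans (s≤s (ℕ.≤-trans (s≤s n≤Y) (s≤s Y≤Y₀)))
              (few-fixed {Y₀} {z ^ p ∷ z ∷ (z ^ p) ^ p ∷ []} (filter⁺ (λ y → ¬? (y ≟ 0#)) Y-unique)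
                (λ y∈ → let (y∈Y , ne) = ∈-filter⁻ (λ y → ¬? (y ≟ 0#)) {xs = Y} y∈ in ne , ∈Y⁻ y∈Y)
                (∷-unique (λ { (here e) → z₁≢z e ; (there (here e)) → z₁≢z (sym (frobenius-injective e)) })
                  (∷-unique (λ { (here e) → z₂≢z (sym e) }) (∷-unique (λ ()) [])))
                λ { (here refl) → C-frobenius N z∈ , λ e → z₁≢z (frobenius-injective e)
                  ; (there (here refl)) → z∈ , z₁≢z
                  ; (there (there (here refl))) → C-frobenius N (C-frobenius N z∈) ,
                      λ e → z₁≢z (frobenius-injective (frobenius-injective e)) }))

            S-suc : S 2 1# → ∀ k {x} → S (suc k) x → S (2 ℕ.+ k) x
            S-suc s₁ k {x} (t , et , s) = subst (S (2 ℕ.+ k))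
              (trans (cong (_+ (x - t)) (*-identityʳ t)) (solve 2 (λ x t → t :+ (x :- t) := x) refl x t))
              (S-+ 2 (S-scale 2 et s₁) s)

          -- If 1 were a sum of two roots, so would be every root, and `S n` would lie in
          -- `S (n + 1)`. Then `X`, which avoids 0, and the orbit of `z` would give n + 2 cosets
          -- there.
          ¬S₂1 : ¬ S 2 1#
          ¬S₂1 s₁ = ℕ.1+n≰n (ℕ.≤-trans (ℕ.+-monoʳ-≤ 2 n≤X) (few-fixed X-unique
            (λ x∈ → let (ne , fx , sx) = ∈X⁻ x∈ in ne , fx , up n≥2 sx) pair-unique pair-moved))
            where
            up : ∀ {n x} → 2 ≤ n → S n x → S (suc n) x
            up {suc k} _ s = S-suc s₁ k s

          -- For p = 3 the two fixed cosets in `S 2` are named by square roots of 1. One is the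
          -- coset of 1 + 1, whose name is not 1, so the other is the coset of 1, which `¬S₂1`
          -- excludes.
          p≢3 : p ≢ 3
          p≢3 p≡3 with C-missing 2 ((1# + 1#) ^ h ∷ []) (ℕ.≤-trans (s≤s (s≤s (s≤s z≤n))) (ℕ.≤-trans (ℕ.n≤1+n _) (ℕ.≤-trans (s≤s p≥3) p<d))) (s≤s (s≤s z≤n))
          ... | c , c∈@(y , y≢0 , s , yc) , c∉ = ¬S₂1 (S-invariant 2 y≢0 (trans (1^ h) (sym (trans yc c≡1))) s)
            where
            c≡1 : c ≡ 1#
            c≡1 = decidable-stable (c ≟ 1#) λ c≢1 → ℕ.1+n≰n (roots-of-unity-bound 2 (s≤s z≤n) {c ∷ 1# ∷ (1# + 1#) ^ h ∷ []}
              (∷-unique (λ { (here e) → c≢1 e ; (there e) → c∉ e }) (∷-unique (λ { (here e) → 2^h≢1 (sym e) }) (∷-unique (λ ()) [])))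
              λ { (here refl) → square (C-≢0 2 c∈) (fixed-C₂ c∈)
                ; (there (here refl)) → 1^ 2
                ; (there (there (here refl))) → square (C-≢0 2 C-two) (fixed-C₂ C-two) })
              where
              square : ∀ {x} → x ≢ 0# → x ^ p ≡ x → x ^ 2 ≡ 1#
              square {x} ne fx = subst (λ q → x ^ (q ∸ 1) ≡ 1#) p≡3 (pred p p≥1 ne fx)
              2^h≢1 : (1# + 1#) ^ h ≢ 1#
              2^h≢1 e = 1≢0 (+-cancelʳ 1# (trans (fixed-powers-injective 2≢0 1≢0 2^p (1^ p) (trans e (sym (1^ h)))) (sym (+-identityˡ 1#))))

          private
            ^-pred : ∀ {x} → x ≢ 0# → (x ^ p) ^ p ≡ x → x ^ (p ℕ.* p ∸ 1) ≡ 1#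
            ^-pred {x} ne e = pred (p ℕ.* p) p²≥1 ne (trans (sym (^-assocʳ x p p)) e)
            z-unit : z ^ (p ℕ.* p ∸ 1) ≡ 1#
            z-unit = ^-pred (C-≢0 N z∈) period-two
            -- `w` is the representative of the coset `z` in F_(p²), and `w₁` is its conjugate.
            w w₁ : Carrier
            w = z ^ b₂
            w₁ = w ^ p
            w^h : w ^ h ≡ z
            w^h = power-root {h} {p ℕ.* p ∸ 1} {b₂} {k₂} inv₂ z-unit
            w₂ : w₁ ^ p ≡ w
            w₂ = trans (cong (_^ p) (^-swap z b₂ p)) (trans (^-swap (z ^ p) b₂ p) (cong (_^ b₂) period-two))
            moved : w₁ ≢ w
            moved e = z₁≢z (trans (cong (_^ p) (sym w^h)) (trans (^-swap w h p) (trans (cong (_^ h) e) w^h)))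
            Sw : S N w
            Sw = let (y , y≢0 , s , e) = z∈ in S-invariant N y≢0 (trans w^h (sym e)) s
            Sw₁ : S N w₁
            Sw₁ = S-frobenius N Sw

            a : ∃ λ a → a ∈ Y × a ∉ 0# ∷ []
            a = missing _≟_ Y-unique (ℕ.≤-trans n≥2 n≤Y)
            a₀ = proj₁ a

            -- Each entry is a sum of two elements of `S N`; for `a₀` the other one is 0. These are
            -- at least 2 n + 3 distinct nonzero elements of F_(p²), and since `h` is prime to p² -
            -- 1 they lie in different cosets, one too many for `S (N + N)`.
            L : List Carrier
            L = a₀ ∷ w + w ∷ w₁ + w₁ ∷ (map (_+ w) Y ++ map (_+ w₁) Y)

            count : 3 ℕ.+ (length Y ℕ.+ length Y) ≡ length (map (_^ h) L)
            count = sym (trans (length-map (_^ h) L) (cong (3 ℕ.+_) (trans (length-++ (map (_+ w) Y))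
              (cong₂ ℕ._+_ (length-map (_+ w) Y) (length-map (_+ w₁) Y)))))

            Moving : Carrier → Set
            Moving x = x ^ p ≢ x

            twice-injective : ∀ {x y} → x + x ≡ y + y → x ≡ y
            twice-injective {x} {y} e = decidable-stable (x ≟ y) λ ne → double-≢0 (λ q → ne (sub-≡0 q))
              (trans (solve 2 (λ x y → (x :- y) :+ (x :- y) := (x :+ x) :- (y :+ y)) refl x y)
                (trans (cong (_- (y + y)) e) (-‿inverseʳ _)))

            moving-ww : ∀ {v} → Moving v → Moving (v + v)
            moving-ww {v} mv e = mv (twice-injective (trans (sym (frobenius-+ v v)) e))

            moving-+ : ∀ {v y} → y ^ p ≡ y → Moving v → Moving (y + v)
            moving-+ {v} {y} fy mv e = mv (+-cancelʳ y (trans (+-comm _ y) (trans (cong (_+ v ^ p) (sym fy))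
              (trans (sym (frobenius-+ y v)) (trans e (+-comm y v))))))

            moving-w₁ : Moving w₁
            moving-w₁ e = moved (trans (sym e) w₂)

            3≢0 : ∀ {x} → x + (x + x) ≡ 0# → x ≡ 0#
            3≢0 {x} e = decidable-stable (x ≟ 0#) λ ne → product-≢0 ne
              (small-≢0 {3} (s≤s z≤n) (ℕ.≤∧≢⇒< p≥3 (λ q → p≢3 (sym q))))
              (trans (cong (x *_) (cong (λ q → 1# + (1# + q)) (+-identityʳ 1#)))
                (trans (solve 2 (λ x o → x :* (o :+ (o :+ o)) := x :* o :+ (x :* o :+ x :* o)) refl x 1#)
                  (trans (cong (λ q → q + (q + q)) (*-identityʳ x)) e)))

            -- Subtracting the conjugate equation 2 v = y + u leaves 3 (u - v) = 0. Here p = 3 would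
            -- be fatal.
            crossed : ∀ {u v y} → u ^ p ≡ v → v ^ p ≡ u → y ^ p ≡ y → u + u ≡ y + v → u ≡ v
            crossed {u} {v} {y} uv vu fy e = sub-≡0 (3≢0 (trans
              (solve 3 (λ u v y → (u :- v) :+ ((u :- v) :+ (u :- v)) := ((u :+ u) :- (y :+ v)) :- ((v :+ v) :- (y :+ u))) refl u v y)
              (trans (cong₂ _-_ (trans (cong (_- (y + v)) e) (-‿inverseʳ _)) (trans (cong (_- (y + u)) e′) (-‿inverseʳ _))) (-‿inverseʳ 0#))))
              where
              e′ : v + v ≡ y + u
              e′ = trans (cong₂ _+_ (sym uv) (sym uv)) (trans (sym (frobenius-+ u u)) (trans (cong (_^ p) e)
                (trans (frobenius-+ y v) (cong₂ _+_ fy vu))))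

            -- Subtracting the conjugate equation y + w₁ = y′ + w leaves 2 (w₁ - w) = 0.
            parallel : ∀ {y y′} → y ^ p ≡ y → y′ ^ p ≡ y′ → y + w ≢ y′ + w₁
            parallel {y} {y′} fy fy′ e = moved (twice-injective (sub-≡0
              (trans (solve 4 (λ y y′ w w₁ → (w₁ :+ w₁) :- (w :+ w) := ((y :+ w₁) :- (y′ :+ w)) :- ((y :+ w) :- (y′ :+ w₁))) refl y y′ w w₁)
              (trans (cong₂ _-_ (trans (cong (_- (y′ + w)) e′) (-‿inverseʳ _)) (trans (cong (_- (y′ + w₁)) e) (-‿inverseʳ _))) (-‿inverseʳ 0#)))))
              where
              e′ : y + w₁ ≡ y′ + w
              e′ = trans (cong (_+ w₁) (sym fy)) (trans (sym (frobenius-+ y w)) (trans (cong (_^ p) e)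
                (trans (frobenius-+ y′ w₁) (cong₂ _+_ fy′ w₂))))

            translates : Unique (map (_+ w) Y ++ map (_+ w₁) Y)
            translates = ++⁺ (map⁺ (+-cancelʳ w) Y-unique) (map⁺ (+-cancelʳ w₁) Y-unique) disjoint
              where
              disjoint : ∀ {x} → ¬ (x ∈ map (_+ w) Y × x ∈ map (_+ w₁) Y)
              disjoint (p₁ , p₂) with ∈-map⁻ (_+ w) p₁ | ∈-map⁻ (_+ w₁) p₂
              ... | y , y∈ , refl | y′ , y′∈ , e = parallel (proj₁ (∈Y⁻ y∈)) (proj₁ (∈Y⁻ y′∈)) e

            ∈translates : ∀ {x} → x ∈ map (_+ w) Y ++ map (_+ w₁) Y → ∃ λ y → (y ∈ Y) × (x ≡ y + w ⊎ x ≡ y + w₁)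
            ∈translates x∈ with ∈-++⁻ (map (_+ w) Y) x∈
            ... | inj₁ q = let (y , y∈ , e) = ∈-map⁻ (_+ w) q in y , y∈ , inj₁ e
            ... | inj₂ q = let (y , y∈ , e) = ∈-map⁻ (_+ w₁) q in y , y∈ , inj₂ e

            moving-translates : ∀ {x} → x ∈ map (_+ w) Y ++ map (_+ w₁) Y → Moving x
            moving-translates x∈ with ∈translates x∈
            ... | y , y∈ , inj₁ refl = moving-+ (proj₁ (∈Y⁻ y∈)) moved
            ... | y , y∈ , inj₂ refl = moving-+ (proj₁ (∈Y⁻ y∈)) moving-w₁

            fixed∉ : ∀ {x y} → x ^ p ≡ x → Moving y → x ≢ y
            fixed∉ fx my refl = my fx

            a₀-fixed : a₀ ^ p ≡ a₀
            a₀-fixed = proj₁ (∈Y⁻ (proj₁ (proj₂ a)))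

            double∉ : ∀ {u v} → u ^ p ≡ v → v ^ p ≡ u → u ≢ v → ∀ {y} → y ∈ Y → u + u ≢ y + v × u + u ≢ y + u
            double∉ {u} uv vu ne {y} y∈ = (λ e → ne (crossed uv vu (proj₁ (∈Y⁻ y∈)) e))
              , (λ e → ne (trans (trans (+-cancelʳ u e) (trans (sym (proj₁ (∈Y⁻ y∈))) (cong (_^ p) (sym (+-cancelʳ u e))))) uv))

            L-unique : Unique L
            L-unique = ∷-unique (λ { (here e) → fixed∉ a₀-fixed (moving-ww moved) e
                                   ; (there (here e)) → fixed∉ a₀-fixed (moving-ww moving-w₁) e
                                   ; (there (there x∈)) → fixed∉ a₀-fixed (moving-translates x∈) refl })
              (∷-unique (λ { (here e) → moved (sym (twice-injective e))
                           ; (there x∈) → ww∉ x∈ })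
              (∷-unique w₁w₁∉ translates))
              where
              ww∉ : w + w ∉ map (_+ w) Y ++ map (_+ w₁) Y
              ww∉ x∈ with ∈translates x∈
              ... | y , y∈ , inj₁ e = proj₂ (double∉ refl w₂ (λ q → moved (sym q)) y∈) e
              ... | y , y∈ , inj₂ e = proj₁ (double∉ refl w₂ (λ q → moved (sym q)) y∈) e
              w₁w₁∉ : w₁ + w₁ ∉ map (_+ w) Y ++ map (_+ w₁) Y
              w₁w₁∉ x∈ with ∈translates x∈
              ... | y , y∈ , inj₁ e = proj₁ (double∉ w₂ refl moved y∈) e
              ... | y , y∈ , inj₂ e = proj₂ (double∉ w₂ refl moved y∈) e

            Good : Carrier → Set
            Good x = x ≢ 0# × S (N ℕ.+ N) x × (x ^ p) ^ p ≡ x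

            moving-≢0 : ∀ {x} → Moving x → x ≢ 0#
            moving-≢0 mx refl = mx 0^p

            good-+ : ∀ {u v} → S N u → S N v → (u ^ p) ^ p ≡ u → (v ^ p) ^ p ≡ v → u + v ≢ 0# → Good (u + v)
            good-+ {u} {v} su sv pu pv ne = ne , S-+ N su sv ,
              trans (cong (_^ p) (frobenius-+ u v)) (trans (frobenius-+ _ _) (cong₂ _+_ pu pv))

            w₁-period : (w₁ ^ p) ^ p ≡ w₁
            w₁-period = cong (_^ p) w₂

            good : ∀ {x} → x ∈ L → Good x
            good (here refl) = subst Good (+-identityʳ a₀) (good-+ (proj₂ (∈Y⁻ (proj₁ (proj₂ a)))) zero∈Y
              (trans (cong (_^ p) a₀-fixed) a₀-fixed) (trans (cong (_^ p) 0^p) 0^p)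
              (λ e → proj₂ (proj₂ a) (here (trans (sym (+-identityʳ a₀)) e))))
            good (there (here refl)) = good-+ Sw Sw w₂ w₂ (moving-≢0 (moving-ww moved))
            good (there (there (here refl))) = good-+ Sw₁ Sw₁ w₁-period w₁-period (moving-≢0 (moving-ww moving-w₁))
            good (there (there (there x∈))) with ∈translates x∈ | moving-translates x∈
            ... | y , y∈ , inj₁ refl | m = let (fy , sy) = ∈Y⁻ y∈ in good-+ sy Sw (trans (cong (_^ p) fy) fy) w₂ (moving-≢0 m)
            ... | y , y∈ , inj₂ refl | m = let (fy , sy) = ∈Y⁻ y∈ in good-+ sy Sw₁ (trans (cong (_^ p) fy) fy) w₁-period (moving-≢0 m)

            good-powers-injective : ∀ {x y} → Good x → Good y → x ^ h ≡ y ^ h → x ≡ y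
            good-powers-injective {x} {y} (x≢0 , _ , px) (y≢0 , _ , py) e =
              trans (sym (root-power {h} {p ℕ.* p ∸ 1} {b₂} {k₂} inv₂ {x} (^-pred x≢0 px)))
                (trans (cong (_^ b₂) e) (root-power {h} {p ℕ.* p ∸ 1} {b₂} {k₂} inv₂ {y} (^-pred y≢0 py)))

            powers-injective : ∀ {x y} → x ∈ L → y ∈ L → x ^ h ≡ y ^ h → x ≡ y
            powers-injective x∈ y∈ = good-powers-injective (good x∈) (good y∈)

            good-power : ∀ {x} → Good x → InC (N ℕ.+ N) (x ^ h)
            good-power {x} (x≢0 , s , _) = x , x≢0 , s , refl

            L-in : ∀ {x} → x ∈ map (_^ h) L → InC (N ℕ.+ N) x
            L-in x∈ = let (y , y∈ , e) = ∈-map⁻ (_^ h) {xs = L} x∈ in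
              subst (InC (N ℕ.+ N)) (sym e) (good-power (good y∈))

          impossible : ⊥
          impossible = ℕ.1+n≰n (ℕ.≤-trans (ℕ.+-monoʳ-≤ 3 (ℕ.+-mono-≤ n≤Y n≤Y)) (ℕ.≤-trans (ℕ.≤-reflexive count)
            (ℕ.≤-trans (C-≤ (N ℕ.+ N) (map (_^ h) L) (map-unique powers-injective L-unique) L-in) (ℕ.≤-reflexive (cong suc (ℕ.+-suc n n))))))

        general : ∀ {b₂ k₂} → h ℕ.* b₂ ≡ 1 ℕ.+ (p ℕ.* p ∸ 1) ℕ.* k₂ → ⊥
        general {b₂} {k₂} inv₂ =
          let (n , n≥2 , n<p , fixed , z , z∈ , ne) = first-moved (p ∸ 2) 2 fixed-C₂ (subst Moved (sym (ℕ.m∸n+n≡m (ℕ.<⇒≤ p≥3))) moved-p)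
          in FirstMoved.impossible {b₂} {k₂} inv₂ n≥2 (ℕ.<-trans (subst (n <_) (ℕ.m∸n+n≡m (ℕ.<⇒≤ p≥3)) n<p) p<d) fixed z∈ ne

-- Exhaustive search over coefficient vectors.

module _ {ℓ₁ ℓ₂ : Level} where

  -- Both alternatives carry evidence: `Q` will be a certificate that a division leaves a nonzero
  -- remainder, which is more than the negation of `P`.
  Exhaust : Set → Set _
  Exhaust A = ∀ {P : A → Set ℓ₁} {Q : A → Set ℓ₂} → (∀ a → P a ⊎ Q a) → ∃ P ⊎ (∀ a → Q a)

  exhaust-Fin : ∀ n → Exhaust (Fin n)
  exhaust-Fin zero dec = inj₂ λ ()
  exhaust-Fin (suc n) dec with dec Fin.zero | exhaust-Fin n (λ i → dec (Fin.suc i))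
  ... | inj₁ p | _ = inj₁ (_ , p)
  ... | inj₂ _ | inj₁ (i , p) = inj₁ (_ , p)
  ... | inj₂ q | inj₂ qs = inj₂ λ { Fin.zero → q ; (Fin.suc i) → qs i }

exhaust-Vec : ∀ {ℓ₁ ℓ₂} {p} n → Exhaust {ℓ₁} {ℓ₂} (Vec (Fin p) n)
exhaust-Vec zero dec with dec []
... | inj₁ p = inj₁ (_ , p)
... | inj₂ q = inj₂ λ { [] → q }
exhaust-Vec (suc n) dec with exhaust-Fin _ (λ c → exhaust-Vec n (λ v → dec (c ∷ v)))
... | inj₁ (c , v , p) = inj₁ (c ∷ v , p)
... | inj₂ q = inj₂ λ { (c ∷ v) → q c v }

allVecs : ∀ p n → List (Vec (Fin p) n)
allVecs p zero    = List.[ [] ]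
allVecs p (suc n) = List.cartesianProductWith _∷_ (List.allFin p) (allVecs p n)

∈-allVecs : ∀ {p n} (v : Vec (Fin p) n) → v ∈ allVecs p n
∈-allVecs []      = here ≡.refl
∈-allVecs (c ∷ v) = ∈-cartesianProductWith⁺ _∷_ (∈-allFin c) (∈-allVecs v)

allVecs-unique : ∀ p n → Unique (allVecs p n)
allVecs-unique p zero = All.[] ∷ []
allVecs-unique p (suc n) = cartesianProductWith⁺ _∷_ Vec.∷-injective (allFin⁺ p) (allVecs-unique p n)

-- Construction of the finite field K inside the algebraic closure.

module Extension {p c ℓ} (F : AlgClosureFp p c ℓ) (p-prime : Prime p) where
  open AlgClosureFp F
  open DifferenceSolver commRing using (solve; _:=_; _:+_; _:*_; _:-_; :-_)
  open import Algebra.Properties.Semiring.Mult semiring using (×-homo-+; ×1-homo-*; ×-congˡ; ×-homo-1)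
  open import Algebra.Properties.Semiring.Exp semiring using (^-congˡ)
  open import Algebra.Properties.Semiring.Sum semiring using (sum-cong-≋; *-distribˡ-sum)
  open import Algebra.Properties.Ring ring using (-‿distribˡ-*)
  open import Relation.Binary.Reasoning.Setoid setoid

  private
    instance
      p-nonZero : NonZero p
      p-nonZero = prime⇒nonZero p-prime

    p≥1 : 1 ≤ p
    p≥1 = ℕ.>-nonZero⁻¹ p

    _∙_ = trans
    infixr 4 _∙_

  [_] : Fin p → Carrier
  [ c ] = toℕ c · 1#

  InPrimeField : Carrier → Set ℓ
  InPrimeField x = ∃ λ c → x ≈ [ c ]

  multiple∈ : ∀ n → InPrimeField (n · 1#)
  multiple∈ n = fromℕ< (m%n<n n p) , (begin
    n · 1#                               ≈⟨ ×-congˡ (m≡m%n+[m/n]*n n p) ⟩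
    (n % p ℕ.+ (n / p) ℕ.* p) · 1#       ≈⟨ ×-homo-+ 1# (n % p) _ ⟩
    (n % p) · 1# + ((n / p) ℕ.* p) · 1#  ≈⟨ +-congˡ (×1-homo-* (n / p) p ∙ *-congˡ charP ∙ zeroʳ _) ⟩
    (n % p) · 1# + 0#                    ≈⟨ +-identityʳ _ ⟩
    (n % p) · 1#                         ≈⟨ ×-congˡ (toℕ-fromℕ< (m%n<n n p)) ⟨
    toℕ (fromℕ< (m%n<n n p)) · 1# ∎)

  +∈ : ∀ c d → InPrimeField ([ c ] + [ d ])
  +∈ c d = let (e , eq) = multiple∈ (toℕ c ℕ.+ toℕ d) in e , (sym (×-homo-+ 1# (toℕ c) (toℕ d)) ∙ eq)

  *∈ : ∀ c d → InPrimeField ([ c ] * [ d ])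
  *∈ c d = let (e , eq) = multiple∈ (toℕ c ℕ.* toℕ d) in e , (sym (×1-homo-* (toℕ c) (toℕ d)) ∙ eq)

  neg∈ : ∀ c → InPrimeField (- [ c ])
  neg∈ c = let (e , eq) = multiple∈ ((p ∸ 1) ℕ.* toℕ c) in e , (begin
    - [ c ]                                ≈⟨ +-identityʳ _ ⟨
    - [ c ] + 0#                           ≈⟨ +-congˡ (×1-homo-* p (toℕ c) ∙ *-congʳ charP ∙ zeroˡ _) ⟨
    - [ c ] + (p ℕ.* toℕ c) · 1#           ≈⟨ +-congˡ (×-congˡ (≡.cong (ℕ._* toℕ c) (≡.sym (ℕ.m+[n∸m]≡n p≥1)))) ⟩
    - [ c ] + (toℕ c ℕ.+ (p ∸ 1) ℕ.* toℕ c) · 1#  ≈⟨ +-congˡ (×-homo-+ 1# (toℕ c) _) ⟩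
    - [ c ] + ([ c ] + ((p ∸ 1) ℕ.* toℕ c) · 1#)  ≈⟨ solve 2 (λ a b → :- a :+ (a :+ b) := b) refl [ c ] _ ⟩
    ((p ∸ 1) ℕ.* toℕ c) · 1#               ≈⟨ eq ⟩
    [ e ] ∎)

  -‿∈ : ∀ c d → InPrimeField ([ c ] - [ d ])
  -‿∈ c d = let (e , eq) = neg∈ d ; (f , eq′) = +∈ c e in f , (+-congˡ eq ∙ eq′)

  coprime-invertible : ∀ {n} → Coprime n p → 1 ≤ n → ∃ λ b → n · 1# * [ b ] ≈ 1#
  coprime-invertible {n} cop n≥1 with coprime-inverse cop n≥1
  ... | b , k , inv with multiple∈ b
  ...   | b′ , eq = b′ , (begin
    n · 1# * [ b′ ]   ≈⟨ *-congˡ eq ⟨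
    n · 1# * (b · 1#) ≈⟨ ×1-homo-* n b ⟨
    (n ℕ.* b) · 1#    ≈⟨ ×-congˡ inv ⟩
    1# + (p ℕ.* k) · 1# ≈⟨ +-congˡ (×1-homo-* p k ∙ *-congʳ charP ∙ zeroˡ _) ⟩
    1# + 0#           ≈⟨ +-identityʳ 1# ⟩
    1# ∎)

  small-invertible : ∀ {n} → 1 ≤ n → n < p → ∃ λ b → n · 1# * [ b ] ≈ 1#
  small-invertible {suc n} n≥1 n<p = coprime-invertible (Coprimality.sym (prime⇒coprime p-prime n<p)) n≥1

  invertible-≉0 : ∀ {x y} → x * y ≈ 1# → ¬ (x ≈ 0#)
  invertible-≉0 {x} {y} xy x0 = nontrivial (sym xy ∙ *-congʳ x0 ∙ zeroˡ y)

  private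
    distinct : ∀ {m n} → m < n → n < p → ¬ (m · 1# ≈ n · 1#)
    distinct {m} {n} m<n n<p e = invertible-≉0
      (proj₂ (small-invertible (ℕ.m<n⇒0<n∸m m<n) (ℕ.≤-<-trans (ℕ.m∸n≤m n m) n<p)))
      (begin
        (n ∸ m) · 1#                     ≈⟨ solve 2 (λ a b → b := (a :+ b) :- a) refl (m · 1#) _ ⟩
        (m · 1# + (n ∸ m) · 1#) - m · 1# ≈⟨ +-congʳ (×-homo-+ 1# m (n ∸ m)) ⟨
        (m ℕ.+ (n ∸ m)) · 1# - m · 1#    ≈⟨ +-cong (×-congˡ (ℕ.m+[n∸m]≡n (ℕ.<⇒≤ m<n)) ∙ sym e) refl ⟩
        m · 1# - m · 1#                  ≈⟨ -‿inverseʳ _ ⟩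
        0# ∎)

  -- A nonzero residue is invertible by Bézout. Residue 0 would identify two different multiples of
  -- 1 below p, whose difference is invertible.
  difference-invertible : ∀ {c d} → c ≢ d → ∃ λ a → ∃ λ b → ([ c ] - [ d ] ≈ [ a ]) × [ a ] * [ b ] ≈ 1#
  difference-invertible {c} {d} c≢d with -‿∈ c d
  ... | a , eq with toℕ a in a≡
  ...   | suc n = let (b , inv) = small-invertible {suc n} (s≤s z≤n) (≡.subst (_< p) a≡ (toℕ<n a)) in
                  a , b , (eq ∙ ×-congˡ (≡.sym a≡)) , (*-congʳ (×-congˡ a≡) ∙ inv)
  ...   | zero with ℕ.<-cmp (toℕ c) (toℕ d) | (begin
            [ c ]                   ≈⟨ solve 2 (λ c d → c := (c :- d) :+ d) refl [ c ] [ d ] ⟩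
            ([ c ] - [ d ]) + [ d ] ≈⟨ +-congʳ eq ⟩
            0# + [ d ]              ≈⟨ +-identityˡ _ ⟩
            [ d ] ∎)
  ...     | tri< lt _ _ | e = contradiction e (distinct lt (toℕ<n d))
  ...     | tri≈ _ q _  | e = contradiction (toℕ-injective q) c≢d
  ...     | tri> _ _ gt | e = contradiction (sym e) (distinct gt (toℕ<n c))

  Poly : ℕ → Set
  Poly n = Vec (Fin p) n

  ev mev : ∀ {n} → Poly n → Carrier → Carrier
  ev []       x = 0#
  ev (c ∷ cs) x = [ c ] + x * ev cs x
  -- the leading coefficient 1 of a monic polynomial is not stored
  mev []       x = 1#
  mev (c ∷ cs) x = [ c ] + x * mev cs x

  zeroᶠ : Fin p
  zeroᶠ = proj₁ (multiple∈ 0)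

  oneᶠ : Fin p
  oneᶠ = proj₁ (multiple∈ 1)

  one≈ : 1# ≈ [ oneᶠ ]
  one≈ = sym (×-homo-1 1#) ∙ proj₂ (multiple∈ 1)

  ev-zeros : ∀ n x → ev (replicate n zeroᶠ) x ≈ 0#
  ev-zeros zero x = refl
  ev-zeros (suc n) x = +-cong (sym (proj₂ (multiple∈ 0))) (*-congˡ (ev-zeros n x) ∙ zeroʳ x) ∙ +-identityˡ 0#

  -- `s` is the top coefficient of `u`; subtracting s f removes it.
  reduce : ∀ {i} (f : Poly i) (u : Poly (suc i)) →
    ∃ λ s → ∃ λ (r : Poly i) → ∀ x → ev u x ≈ [ s ] * mev f x + ev r x
  reduce [] (c ∷ []) = c , [] , λ x → +-cong (sym (*-identityʳ _)) (zeroʳ x)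
  reduce (f₀ ∷ f) (c ∷ u) with reduce f u
  ... | s , r , eq with *∈ s f₀
  ...   | t , teq with -‿∈ c t
  ...     | r₀ , r₀eq = s , r₀ ∷ r , λ x → begin
    [ c ] + x * ev u x                   ≈⟨ +-congˡ (*-congˡ (eq x)) ⟩
    [ c ] + x * ([ s ] * mev f x + ev r x)
      ≈⟨ solve 6 (λ c x s f r f₀ → c :+ x :* (s :* f :+ r) := s :* (f₀ :+ x :* f) :+ ((c :- s :* f₀) :+ x :* r))
           refl [ c ] x [ s ] (mev f x) (ev r x) [ f₀ ] ⟩
    [ s ] * ([ f₀ ] + x * mev f x) + (([ c ] - [ s ] * [ f₀ ]) + x * ev r x)
      ≈⟨ +-congˡ (+-congʳ (+-congˡ (-‿cong teq) ∙ r₀eq)) ⟩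
    [ s ] * ([ f₀ ] + x * mev f x) + ([ r₀ ] + x * ev r x) ∎

  divide : ∀ {i j} (f : Poly i) (g : Poly j) →
    ∃ λ m → ∃ λ (q : Poly m) → ∃ λ (r : Poly i) → ∀ x → mev g x ≈ ev q x * mev f x + ev r x
  divide [] [] = 1 , oneᶠ ∷ [] , [] , λ x →
    sym (+-cong (*-congʳ (+-cong (sym one≈) (zeroʳ x) ∙ +-identityʳ 1#) ∙ *-identityʳ 1#) refl ∙ +-identityʳ 1#)
  divide {suc i} (f₀ ∷ f) [] = 0 , [] , oneᶠ ∷ replicate i zeroᶠ , λ x →
    sym (+-cong (zeroˡ _) (+-cong (sym one≈) (*-congˡ (ev-zeros i x) ∙ zeroʳ x) ∙ +-identityʳ 1#) ∙ +-identityˡ 1#)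
  divide f (c ∷ g) with divide f g
  ... | m , q , r , eq with reduce f (c ∷ r)
  ...   | s , r′ , eq′ = suc m , s ∷ q , r′ , λ x → begin
    [ c ] + x * mev g x                       ≈⟨ +-congˡ (*-congˡ (eq x)) ⟩
    [ c ] + x * (ev q x * mev f x + ev r x)
      ≈⟨ solve 5 (λ c x q f r → c :+ x :* (q :* f :+ r) := x :* q :* f :+ (c :+ x :* r)) refl [ c ] x (ev q x) (mev f x) (ev r x) ⟩
    x * ev q x * mev f x + ([ c ] + x * ev r x) ≈⟨ +-congˡ (eq′ x) ⟩
    x * ev q x * mev f x + ([ s ] * mev f x + ev r′ x)
      ≈⟨ solve 5 (λ s x q f r → x :* q :* f :+ (s :* f :+ r) := (s :+ x :* q) :* f :+ r) refl [ s ] x (ev q x) (mev f x) (ev r′ x) ⟩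
    ([ s ] + x * ev q x) * mev f x + ev r′ x ∎

  -- A positive form of "nonzero of degree below i": leading coefficient `a` with inverse `b`, and
  -- the monic polynomial `f` that remains.
  Normalises : ℕ → (Carrier → Carrier) → Set (c ⊔ ℓ)
  Normalises i φ = ∃ λ j → j < i × ∃ λ (f : Poly j) → ∃ λ a → ∃ λ b →
    [ a ] * [ b ] ≈ 1# × (∀ x → φ x ≈ [ a ] * mev f x)

  normalise : ∀ {i} (u v : Poly i) → u ≡ v ⊎ Normalises i (λ x → ev u x - ev v x)
  normalise [] [] = inj₁ ≡.refl
  normalise (c ∷ u) (d ∷ v) with normalise u v
  ... | inj₂ (j , j<i , f , a , b , ab , eq) with -‿∈ c d
  ...   | e , eeq with *∈ b e
  ...     | f₀ , f₀eq = inj₂ (suc j , s≤s j<i , f₀ ∷ f , a , b , ab , λ x → begin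
    ([ c ] + x * ev u x) - ([ d ] + x * ev v x)
      ≈⟨ solve 5 (λ c d x u v → (c :+ x :* u) :- (d :+ x :* v) := (c :- d) :+ x :* (u :- v)) refl [ c ] [ d ] x (ev u x) (ev v x) ⟩
    ([ c ] - [ d ]) + x * (ev u x - ev v x)  ≈⟨ +-cong (eeq ∙ sym (*-identityˡ _) ∙ *-congʳ (sym ab)) (*-congˡ (eq x)) ⟩
    [ a ] * [ b ] * [ e ] + x * ([ a ] * mev f x)
      ≈⟨ solve 5 (λ a b e x f → a :* b :* e :+ x :* (a :* f) := a :* (b :* e :+ x :* f)) refl [ a ] [ b ] [ e ] x (mev f x) ⟩
    [ a ] * ([ b ] * [ e ] + x * mev f x)    ≈⟨ *-congˡ (+-congʳ f₀eq) ⟩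
    [ a ] * ([ f₀ ] + x * mev f x) ∎)
  normalise (c ∷ u) (d ∷ .u) | inj₁ ≡.refl with c Fin.≟ d
  ... | yes ≡.refl = inj₁ ≡.refl
  ... | no c≢d = let (a , b , aeq , ab) = difference-invertible c≢d in
    inj₂ (0 , s≤s z≤n , [] , a , b , ab , λ x →
      solve 4 (λ c d x u → (c :+ x :* u) :- (d :+ x :* u) := c :- d) refl [ c ] [ d ] x (ev u x) ∙ aeq ∙ sym (*-identityʳ _))

  -- Only the inclusion of roots is kept; it suffices to see that a root of the irreducible factor
  -- is a root of unity.
  Divides : ∀ {i j} → Poly i → Poly j → Set (c ⊔ ℓ)
  Divides f g = ∀ x → mev f x ≈ 0# → mev g x ≈ 0#

  -- no monic f of smaller positive degree leaves remainder 0
  Irreducible : ∀ {e} → Poly e → Set (c ⊔ ℓ)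
  Irreducible {e} g = ∀ (i : Fin (e ∸ 1)) (f : Poly (suc (toℕ i))) →
    ∃ λ m → ∃ λ (q : Poly m) → Normalises (suc (toℕ i)) (λ x → mev g x - ev q x * mev f x)

  -- `g` is divided by every monic polynomial of smaller positive degree. A zero remainder yields a
  -- factor to descend to; if none occurs, the remainders form the certificate of irreducibility.
  -- `fuel` bounds the degree.
  irreducible-factor : ∀ fuel {e} → e < fuel → (g : Poly (suc e)) →
    ∃ λ e′ → ∃ λ (g′ : Poly (suc e′)) → Irreducible g′ × Divides g′ g
  irreducible-factor (suc fuel) {e} (s≤s e≤fuel) g
    with exhaust-Fin e (λ i → exhaust-Vec (suc (toℕ i)) (λ f → test i f))
    where
    zeros : ∀ i → Poly (suc (toℕ {e} i))
    zeros i = replicate _ zeroᶠ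
    test : ∀ i (f : Poly (suc (toℕ i))) → Divides f g ⊎
      ∃ λ m → ∃ λ (q : Poly m) → Normalises (suc (toℕ i)) (λ x → mev g x - ev q x * mev f x)
    test i f with divide f g
    ... | m , q , r , eq with normalise r (zeros i)
    ...   | inj₁ ≡.refl = inj₁ λ x fx → eq x ∙ +-cong (*-congˡ fx ∙ zeroʳ _) (ev-zeros (suc (toℕ i)) x) ∙ +-identityˡ 0#
    ...   | inj₂ (j , j<i , f′ , a , b , ab , eq′) = inj₂ (m , q , j , j<i , f′ , a , b , ab , λ x → begin
      mev g x - ev q x * mev f x                        ≈⟨ +-congʳ (eq x) ⟩
      (ev q x * mev f x + ev r x) - ev q x * mev f x
        ≈⟨ solve 2 (λ A r → (A :+ r) :- A := r) refl (ev q x * mev f x) (ev r x) ⟩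
      ev r x                                            ≈⟨ solve 2 (λ r o → r := (r :- o) :+ o) refl (ev r x) (ev (zeros i) x) ⟩
      (ev r x - ev (zeros i) x) + ev (zeros i) x ≈⟨ +-cong (eq′ x) (ev-zeros (suc (toℕ i)) x) ⟩
      [ a ] * mev f′ x + 0#                             ≈⟨ +-identityʳ _ ⟩
      [ a ] * mev f′ x ∎)
  ... | inj₂ irr = e , g , irr , λ x gx → gx
  ... | inj₁ (i , f , f∣g) with irreducible-factor fuel (ℕ.≤-trans (toℕ<n i) e≤fuel) f
  ...   | e′ , g′ , irr , g′∣f = e′ , g′ , irr , λ x g′x → f∣g x (g′∣f x g′x)

  mev-sum : ∀ {n} (g : Poly n) x → mev g x ≈ x ^ n + sum (λ i → [ lookup g i ] * x ^ toℕ i)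
  mev-sum [] x = sym (+-identityʳ 1#)
  mev-sum {suc n} (c ∷ g) x = begin
    [ c ] + x * mev g x     ≈⟨ +-congˡ (*-congˡ (mev-sum g x)) ⟩
    [ c ] + x * (x ^ n + s) ≈⟨ solve 4 (λ c x q s → c :+ x :* (q :+ s) := x :* q :+ (c :+ x :* s)) refl [ c ] x (x ^ n) s ⟩
    x * x ^ n + ([ c ] + x * s)
      ≈⟨ +-congˡ (+-cong (sym (*-identityʳ _)) (*-distribˡ-sum x t ∙ sum-cong-≋ (λ i →
           solve 3 (λ x a q → x :* (a :* q) := a :* (x :* q)) refl x [ lookup g i ] (x ^ toℕ i)))) ⟩
    x ^ suc n + sum (λ i → [ lookup (c ∷ g) i ] * x ^ toℕ i) ∎
    where t = λ i → [ lookup g i ] * x ^ toℕ i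
          s = sum t

  has-root : ∀ {e} (g : Poly (suc e)) → ∃ λ x → mev g x ≈ 0#
  has-root {e} g = let (x , eq) = algClosed e (λ i → [ lookup g i ]) in x , (mev-sum g x ∙ eq)

  -- The leading term being implicit, n stored coefficients stand for 1 + x + ... + x^n, whose roots
  -- are (n + 1)-st roots of unity.
  ones : ∀ n → Poly n
  ones n = replicate n oneᶠ

  ones-telescope : ∀ n x → (x - 1#) * mev (ones n) x ≈ x ^ suc n - 1#
  ones-telescope zero x = *-identityʳ _ ∙ +-congʳ (sym (*-identityʳ x))
  ones-telescope (suc n) x = begin
    (x - 1#) * ([ oneᶠ ] + x * M) ≈⟨ *-congˡ (+-congʳ (sym one≈)) ⟩
    (x - 1#) * (1# + x * M) ≈⟨ solve 3 (λ x o M → (x :- o) :* (o :+ x :* M) := (x :- o) :* o :+ x :* ((x :- o) :* M)) refl x 1# M ⟩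
    (x - 1#) * 1# + x * ((x - 1#) * M) ≈⟨ +-cong (*-identityʳ _) (*-congˡ (ones-telescope n x)) ⟩
    (x - 1#) + x * (x ^ suc n - 1#) ≈⟨ solve 3 (λ x o q → (x :- o) :+ x :* (q :- o) := (x :* q :- o) :+ (x :- x :* o)) refl x 1# (x ^ suc n) ⟩
    (x ^ suc (suc n) - 1#) + (x - x * 1#) ≈⟨ +-congˡ (+-congˡ (-‿cong (*-identityʳ x)) ∙ -‿inverseʳ x) ∙ +-identityʳ _ ⟩
    x ^ suc (suc n) - 1# ∎
    where M = mev (ones n) x

  -- For n + 1 prime to p this value is a unit, which keeps 1 from being a root.
  ones-at-1 : ∀ n → mev (ones n) 1# ≈ suc n · 1#
  ones-at-1 zero = sym (+-identityʳ 1#)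
  ones-at-1 (suc n) = +-cong (sym one≈) (*-identityˡ _ ∙ ones-at-1 n)

  module Simple {e} (g : Poly (suc e)) (irreducible : Irreducible g) {ζ} (root : mev g ζ ≈ 0#) where

    InK : Carrier → Set ℓ
    InK x = ∃ λ (v : Poly (suc e)) → x ≈ ev v ζ

    private
      resp : ∀ {x y} → x ≈ y → InK y → InK x
      resp eq (v , eq′) = v , (eq ∙ eq′)

      ev-+ : ∀ {n} (u v : Poly n) → ∃ λ (w : Poly n) → ∀ x → ev u x + ev v x ≈ ev w x
      ev-+ [] [] = [] , λ x → +-identityˡ 0#
      ev-+ (c ∷ u) (d ∷ v) =
        let (t , eq) = +∈ c d ; (w , eq′) = ev-+ u v in t ∷ w , λ x →
          solve 5 (λ c d x u v → (c :+ x :* u) :+ (d :+ x :* v) := (c :+ d) :+ x :* (u :+ v)) refl [ c ] [ d ] x (ev u x) (ev v x)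
          ∙ +-cong eq (*-congˡ (eq′ x))

      ev-scale : ∀ {n} s (v : Poly n) → ∃ λ (w : Poly n) → ∀ x → [ s ] * ev v x ≈ ev w x
      ev-scale s [] = [] , λ x → zeroʳ _
      ev-scale s (d ∷ v) =
        let (t , eq) = *∈ s d ; (w , eq′) = ev-scale s v in t ∷ w , λ x →
          solve 4 (λ s d x v → s :* (d :+ x :* v) := s :* d :+ x :* (s :* v)) refl [ s ] [ d ] x (ev v x)
          ∙ +-cong eq (*-congˡ (eq′ x))

      ev-const : ∀ s → ∃ λ (w : Poly (suc e)) → ∀ x → [ s ] ≈ ev w x
      ev-const s = s ∷ replicate e zeroᶠ , λ x → sym (+-congˡ (*-congˡ (ev-zeros e x) ∙ zeroʳ x) ∙ +-identityʳ _)

    +∈K : ∀ {x y} → InK x → InK y → InK (x + y)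
    +∈K (u , ux) (v , vy) = let (w , eq) = ev-+ u v in w , (+-cong ux vy ∙ eq ζ)

    const∈K : ∀ s → InK [ s ]
    const∈K s = let (w , eq) = ev-const s in w , eq ζ

    scale∈K : ∀ s {x} → InK x → InK ([ s ] * x)
    scale∈K s (v , vx) = let (w , eq) = ev-scale s v in w , (*-congˡ vx ∙ eq ζ)

    0∈K : InK 0#
    0∈K = replicate (suc e) zeroᶠ , sym (ev-zeros (suc e) ζ)

    1∈K : InK 1#
    1∈K = resp one≈ (const∈K oneᶠ)

    ζ*∈K : ∀ {x} → InK x → InK (ζ * x)
    ζ*∈K {x} (v , vx) with reduce g (zeroᶠ ∷ v)
    ... | s , r , eq = r , (begin
      ζ * x                      ≈⟨ *-congˡ vx ⟩
      ζ * ev v ζ                 ≈⟨ +-identityˡ _ ⟨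
      0# + ζ * ev v ζ            ≈⟨ +-congʳ (proj₂ (multiple∈ 0)) ⟩
      [ zeroᶠ ] + ζ * ev v ζ     ≈⟨ eq ζ ⟩
      [ s ] * mev g ζ + ev r ζ   ≈⟨ +-congʳ (*-congˡ root ∙ zeroʳ _) ∙ +-identityˡ _ ⟩
      ev r ζ ∎)

    ev*∈K : ∀ {n} (u : Poly n) {x} → InK x → InK (ev u ζ * x)
    ev*∈K [] x∈ = resp (zeroˡ _) 0∈K
    ev*∈K (c ∷ u) {x} x∈ = resp
      (solve 4 (λ c z u x → (c :+ z :* u) :* x := c :* x :+ z :* (u :* x)) refl [ c ] ζ (ev u ζ) x)
      (+∈K (scale∈K c x∈) (ζ*∈K (ev*∈K u x∈)))

    *∈K : ∀ {x y} → InK x → InK y → InK (x * y)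
    *∈K (u , ux) y∈ = resp (*-congʳ ux) (ev*∈K u y∈)

    neg∈K : ∀ {x} → InK x → InK (- x)
    neg∈K {x} x∈ with neg∈ oneᶠ
    ... | m , eq = resp (sym (*-congʳ (sym eq ∙ -‿cong (sym one≈)) ∙ sym (-‿distribˡ-* 1# x) ∙ -‿cong (*-identityˡ x))) (scale∈K m x∈)

    ζ∈K : InK ζ
    ζ∈K = resp (sym (*-identityʳ ζ)) (ζ*∈K 1∈K)

    -- Euclid's algorithm: the remainder of g by f is a multiple of f(ζ) and, by induction, a unit.
    monic-invertible : ∀ fuel {i} → i < fuel → i ≤ e → (f : Poly i) → ∃ λ y → InK y × mev f ζ * y ≈ 1#
    monic-invertible (suc fuel) {zero} _ _ [] = 1# , 1∈K , *-identityˡ 1#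
    monic-invertible (suc fuel) {suc i} (s≤s i<fuel) i<e f
      with irreducible (fromℕ< i<e) (≡.subst (λ k → Poly (suc k)) (≡.sym (toℕ-fromℕ< i<e)) f)
    ... | m , q , j , j≤i , f′ , a , b , ab , eq
      with monic-invertible fuel (ℕ.≤-trans j≤i (ℕ.≤-trans (s≤s (ℕ.≤-reflexive (toℕ-fromℕ< i<e))) i<fuel))
             (ℕ.≤-trans (ℕ.≤-pred j≤i) (ℕ.≤-trans (ℕ.≤-reflexive (toℕ-fromℕ< i<e)) (ℕ.<⇒≤ i<e))) f′
    ...   | y , y∈ , f′y = - ev q ζ * ([ b ] * y) , *∈K (neg∈K (resp (sym (*-identityʳ _)) (ev*∈K q 1∈K))) (scale∈K b y∈) , (begin
      mev f ζ * (- ev q ζ * ([ b ] * y))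
        ≈⟨ solve 4 (λ f q b y → f :* (:- q :* (b :* y)) := :- (q :* f) :* (b :* y)) refl (mev f ζ) (ev q ζ) [ b ] y ⟩
      - (ev q ζ * mev f ζ) * ([ b ] * y)  ≈⟨ *-congʳ (sym (+-identityˡ _) ∙ +-cong (sym root) (-‿cong (*-congˡ (transport f (≡.sym (toℕ-fromℕ< i<e))))) ∙ eq ζ) ⟩
      [ a ] * mev f′ ζ * ([ b ] * y)      ≈⟨ solve 4 (λ a f b y → a :* f :* (b :* y) := (a :* b) :* (f :* y)) refl [ a ] (mev f′ ζ) [ b ] y ⟩
      [ a ] * [ b ] * (mev f′ ζ * y)      ≈⟨ *-cong ab f′y ⟩
      1# * 1#                             ≈⟨ *-identityˡ 1# ⟩
      1# ∎)
      where
      transport : ∀ {k l x} (f : Poly (suc k)) (eq : k ≡ l) → mev f x ≈ mev (≡.subst (λ k → Poly (suc k)) eq f) x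
      transport f ≡.refl = refl

    -- The difference of two distinct vectors evaluates to a unit times f(ζ) with `f` monic of
    -- degree at most e, which is invertible. So equality of values reduces to equality of
    -- coefficient vectors, which is decidable.
    value-injective : ∀ u v → ev {suc e} u ζ ≈ ev v ζ → u ≡ v
    value-injective u v eq with normalise u v
    ... | inj₁ u≡v = u≡v
    ... | inj₂ (j , s≤s j≤e , f , a , b , ab , eq′) with monic-invertible (suc e) (s≤s j≤e) j≤e f
    ...   | y , _ , fy = contradiction (begin
      1#                             ≈⟨ *-identityˡ 1# ⟨
      1# * 1#                        ≈⟨ *-cong ab fy ⟨
      [ a ] * [ b ] * (mev f ζ * y)  ≈⟨ solve 4 (λ a f b y → (a :* b) :* (f :* y) := a :* f :* (b :* y)) refl [ a ] (mev f ζ) [ b ] y ⟩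
      [ a ] * mev f ζ * ([ b ] * y)  ≈⟨ *-congʳ (sym (eq′ ζ) ∙ +-congʳ eq ∙ -‿inverseʳ _) ⟩
      0# * ([ b ] * y)               ≈⟨ zeroˡ _ ⟩
      0# ∎) nontrivial

    inverse∈K : ∀ u → u ≢ proj₁ 0∈K → ∃ λ y → InK y × ev u ζ * y ≈ 1#
    inverse∈K u u≢0 with normalise u (proj₁ 0∈K)
    ... | inj₁ u≡0 = contradiction u≡0 u≢0
    ... | inj₂ (j , s≤s j≤e , f , a , b , ab , eq) with monic-invertible (suc e) (s≤s j≤e) j≤e f
    ...   | y , y∈ , fy = [ b ] * y , scale∈K b y∈ , (begin
      ev u ζ * ([ b ] * y)            ≈⟨ *-congʳ (sym (+-congˡ (-‿cong (sym (proj₂ 0∈K))) ∙ +-congˡ neg-0 ∙ +-identityʳ _) ∙ eq ζ) ⟩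
      [ a ] * mev f ζ * ([ b ] * y)   ≈⟨ solve 4 (λ a f b y → a :* f :* (b :* y) := (a :* b) :* (f :* y)) refl [ a ] (mev f ζ) [ b ] y ⟩
      [ a ] * [ b ] * (mev f ζ * y)   ≈⟨ *-cong ab fy ⟩
      1# * 1#                         ≈⟨ *-identityˡ 1# ⟩
      1# ∎)
      where neg-0 : - 0# ≈ 0#
            neg-0 = sym (+-identityˡ _) ∙ -‿inverseʳ 0#

    rep : ∀ {x} → InK x → Poly (suc e)
    rep = proj₁

    value : Poly (suc e) → Carrier
    value u = ev u ζ

    abstract
      _⊕_ _⊗_ : Poly (suc e) → Poly (suc e) → Poly (suc e)
      u ⊕ v = rep (+∈K (u , refl) (v , refl))
      u ⊗ v = rep (*∈K (u , refl) (v , refl))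

      ⊖_ : Poly (suc e) → Poly (suc e)
      ⊖ u = rep (neg∈K (u , refl))

      𝟘 𝟙 : Poly (suc e)
      𝟘 = rep 0∈K
      𝟙 = rep 1∈K

      value-⊕ : ∀ u v → value (u ⊕ v) ≈ value u + value v
      value-⊕ u v = sym (proj₂ (+∈K (u , refl) (v , refl)))

      value-⊗ : ∀ u v → value (u ⊗ v) ≈ value u * value v
      value-⊗ u v = sym (proj₂ (*∈K (u , refl) (v , refl)))

      value-⊖ : ∀ u → value (⊖ u) ≈ - value u
      value-⊖ u = sym (proj₂ (neg∈K (u , refl)))

      value-𝟘 : value 𝟘 ≈ 0#
      value-𝟘 = sym (proj₂ 0∈K)

      value-𝟙 : value 𝟙 ≈ 1#
      value-𝟙 = sym (proj₂ 1∈K)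

      ζᴷ : Poly (suc e)
      ζᴷ = rep ζ∈K

      value-ζ : value ζᴷ ≈ ζ
      value-ζ = sym (proj₂ ζ∈K)

      ⊗-inverse : ∀ u → u ≢ 𝟘 → ∃ λ v → u ⊗ v ≡ 𝟙
      ⊗-inverse u u≢0 =
        let (y , (v , yv) , uy) = inverse∈K u u≢0 in
        v , value-injective _ _ (value-⊗ u v ∙ *-congˡ (sym yv) ∙ uy ∙ sym value-𝟙)

    inj : ∀ {u v} → value u ≈ value v → u ≡ v
    inj = value-injective _ _

    -- `value` is injective and respects the operations, so each law is pulled back from the
    -- closure.
    poly-isCommutativeRing : IsCommutativeRing _≡_ _⊕_ _⊗_ ⊖_ 𝟘 𝟙
    poly-isCommutativeRing = record
      { isRing = record
        { +-isAbelianGroup = record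
          { isGroup = record
            { isMonoid = record
              { isSemigroup = record
                { isMagma = record { isEquivalence = ≡.isEquivalence ; ∙-cong = ≡.cong₂ _⊕_ }
                ; assoc = λ u v w → inj (value-⊕ _ w ∙ +-congʳ (value-⊕ u v) ∙ +-assoc _ _ _
                    ∙ sym (value-⊕ u _ ∙ +-congˡ (value-⊕ v w))) }
              ; identity = (λ u → inj (value-⊕ 𝟘 u ∙ +-congʳ value-𝟘 ∙ +-identityˡ _))
                         , (λ u → inj (value-⊕ u 𝟘 ∙ +-congˡ value-𝟘 ∙ +-identityʳ _)) }
            ; inverse = (λ u → inj (value-⊕ (⊖ u) u ∙ +-congʳ (value-⊖ u) ∙ -‿inverseˡ _ ∙ sym value-𝟘))
                      , (λ u → inj (value-⊕ u (⊖ u) ∙ +-congˡ (value-⊖ u) ∙ -‿inverseʳ _ ∙ sym value-𝟘))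
            ; ⁻¹-cong = ≡.cong ⊖_ }
          ; comm = λ u v → inj (value-⊕ u v ∙ +-comm _ _ ∙ sym (value-⊕ v u)) }
        ; *-cong = ≡.cong₂ _⊗_
        ; *-assoc = λ u v w → inj (value-⊗ _ w ∙ *-congʳ (value-⊗ u v) ∙ *-assoc _ _ _
            ∙ sym (value-⊗ u _ ∙ *-congˡ (value-⊗ v w)))
        ; *-identity = (λ u → inj (value-⊗ 𝟙 u ∙ *-congʳ value-𝟙 ∙ *-identityˡ _))
                     , (λ u → inj (value-⊗ u 𝟙 ∙ *-congˡ value-𝟙 ∙ *-identityʳ _))
        ; distrib = (λ u v w → inj (value-⊗ u _ ∙ *-congˡ (value-⊕ v w) ∙ distribˡ _ _ _
                      ∙ sym (value-⊕ _ _ ∙ +-cong (value-⊗ u v) (value-⊗ u w))))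
                  , (λ u v w → inj (value-⊗ _ u ∙ *-congʳ (value-⊕ v w) ∙ distribʳ _ _ _
                      ∙ sym (value-⊕ _ _ ∙ +-cong (value-⊗ v u) (value-⊗ w u)))) }
      ; *-comm = λ u v → inj (value-⊗ u v ∙ *-comm _ _ ∙ sym (value-⊗ v u)) }

    finiteField : FiniteField
    finiteField = record
      { isCommutativeRing = poly-isCommutativeRing
      ; 1≢0 = λ q → nontrivial (sym value-𝟙 ∙ reflexive (≡.cong value q) ∙ value-𝟘)
      ; invert = ⊗-inverse
      ; _≟_ = Vec.≡-dec Fin._≟_
      ; elements = allVecs p (suc e)
      ; elements-unique = allVecs-unique p (suc e)
      ; complete = ∈-allVecs }

    module K = FieldProperties finiteField

    value-^ : ∀ u n → value (u K.^ n) ≈ value u ^ n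
    value-^ u zero = value-𝟙
    value-^ u (suc n) = value-⊗ u _ ∙ *-congˡ (value-^ u n)

    value-· : ∀ n → value (n K.· 𝟙) ≈ n · 1#
    value-· zero = value-𝟘
    value-· (suc n) = value-⊕ 𝟙 _ ∙ +-cong value-𝟙 (value-· n)

    SpannedValue : Carrier → Set ℓ
    SpannedValue x = ∃ λ u → K.Span ζᴷ u × value u ≈ x

    -- A coefficient is a residue in ℕ, so its product with ζ^i is a repeated sum of ζ^i.
    span-multiple : ∀ i k {x} → SpannedValue x → SpannedValue (k · 1# * ζ ^ i + x)
    span-multiple i zero (u , sp , eq) = u , sp , (eq ∙ sym (+-congʳ (zeroˡ _) ∙ +-identityˡ _))
    span-multiple i (suc k) {x} s =
      let (u , sp , eq) = span-multiple i k s in (ζᴷ K.^ i) ⊕ u , K._∷_ i sp ,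
        (value-⊕ _ u ∙ +-cong (value-^ ζᴷ i ∙ ^-congˡ i (value-ζ) ∙ sym (*-identityˡ _)) eq
         ∙ solve 4 (λ o z k x → o :* z :+ (k :* z :+ x) := (o :+ k) :* z :+ x) refl 1# (ζ ^ i) (k · 1#) x)

    span-ev : ∀ {n} i (v : Poly n) → SpannedValue (ζ ^ i * ev v ζ)
    span-ev i [] = 𝟘 , K.Span.[] , (value-𝟘 ∙ sym (zeroʳ _))
    span-ev i (c ∷ v) = let (u , sp , eq) = span-multiple i (toℕ c) (span-ev (suc i) v) in
      u , sp , (eq ∙ solve 4 (λ c z z′ v → c :* z′ :+ z :* z′ :* v := z′ :* (c :+ z :* v)) refl [ c ] ζ (ζ ^ i) (ev v ζ))

    span : ∀ u → K.Span ζᴷ u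
    span u = let (w , sp , eq) = span-ev 0 u in ≡.subst (K.Span ζᴷ) (inj (eq ∙ *-identityˡ _)) sp

    char-K : p K.· 𝟙 ≡ 𝟘
    char-K = inj (value-· p ∙ charP ∙ sym value-𝟘)

    root-K : ∀ h → ζ ^ h ≈ 1# → ζᴷ K.^ h ≡ 𝟙
    root-K h eq = inj (value-^ ζᴷ h ∙ ^-congˡ h value-ζ ∙ eq ∙ sym value-𝟙)

    value-ζ≢1 : ¬ (ζ ≈ 1#) → ζᴷ ≢ 𝟙
    value-ζ≢1 ne q = ne (sym value-ζ ∙ reflexive (≡.cong value q) ∙ value-𝟙)

  -- The interface between construction and counting: sums are counted in the discrete field `K`,
  -- and `φ` carries a vanishing sum of roots of unity into the closure.
  record SubfieldAtRoot (h : ℕ) : Set (Level.suc Level.zero ⊔ c ⊔ ℓ) where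
    field
      K : FiniteField
    open FieldProperties K public using () renaming
      (Carrier to Kᶜ; _+_ to _+ᴷ_; 0# to 0ᴷ; 1# to 1ᴷ; _^_ to _^ᴷ_; _·_ to _·ᴷ_; Span to Spanᴷ)
    field
      φ   : Kᶜ → Carrier
      φ-+ : ∀ u v → φ (u +ᴷ v) ≈ φ u + φ v
      φ-^ : ∀ u n → φ (u ^ᴷ n) ≈ φ u ^ n
      φ-0 : φ 0ᴷ ≈ 0#
      φ-1 : φ 1ᴷ ≈ 1#
      char : p ·ᴷ 1ᴷ ≡ 0ᴷ
      ζ    : Kᶜ
      ζ^h  : ζ ^ᴷ h ≡ 1ᴷ
      ζ≢1  : ζ ≢ 1ᴷ
      spanned : ∀ u → Spanᴷ ζ u

  mev-cong : ∀ {k} (f : Poly k) {x y} → x ≈ y → mev f x ≈ mev f y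
  mev-cong [] _ = refl
  mev-cong (c ∷ f) eq = +-congˡ (*-cong eq (mev-cong f eq))

  ones-root : ∀ n {ζ} → mev (ones n) ζ ≈ 0# → ζ ^ suc n ≈ 1#
  ones-root n {ζ} onesζ = begin
    ζ ^ suc n              ≈⟨ solve 2 (λ z o → z := (z :- o) :+ o) refl (ζ ^ suc n) 1# ⟩
    (ζ ^ suc n - 1#) + 1#  ≈⟨ +-congʳ (sym (ones-telescope n ζ) ∙ *-congˡ onesζ ∙ zeroʳ _) ⟩
    0# + 1#                ≈⟨ +-identityˡ 1# ⟩
    1# ∎

  ones-root-≉1 : ∀ n {ζ} → Coprime (suc n) p → mev (ones n) ζ ≈ 0# → ¬ (ζ ≈ 1#)
  ones-root-≉1 n cop onesζ ζ≈1 = invertible-≉0 (proj₂ (coprime-invertible cop (s≤s z≤n)))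
    (sym (ones-at-1 n) ∙ sym (mev-cong (ones n) ζ≈1) ∙ onesζ)

  fromIrreducible : ∀ {e n} (g : Poly (suc e)) → Irreducible g → Divides g (ones n) → Coprime (suc n) p →
    ∀ {ζ} → mev g ζ ≈ 0# → SubfieldAtRoot (suc n)
  fromIrreducible {n = n} g irr g∣ones cop {ζ} gζ = record
    { K = finiteField ; φ = value ; φ-+ = value-⊕ ; φ-^ = value-^ ; φ-0 = value-𝟘 ; φ-1 = value-𝟙
    ; char = char-K ; ζ = ζᴷ ; ζ^h = root-K (suc n) (ones-root n (g∣ones ζ gζ))
    ; ζ≢1 = value-ζ≢1 (ones-root-≉1 n cop (g∣ones ζ gζ)) ; spanned = span }
    where open Simple g irr gζ

  subfieldAtRoot : ∀ {h} → Coprime h p → 2 ≤ h → SubfieldAtRoot h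
  subfieldAtRoot {suc zero} _ (s≤s ())
  subfieldAtRoot {suc (suc n)} cop _ =
    let (e , g , irr , g∣ones) = irreducible-factor (suc n) ℕ.≤-refl (ones (suc n))
        (ζ , gζ) = has-root g
    in fromIrreducible g irr g∣ones cop gζ

-- Combination of the cases and transfer to the algebraic closure.

open import Data.Nat using (_+_; _*_; _^_)

W-∣ : ∀ {p c ℓ} (F : AlgClosureFp p c ℓ) {h m n} → h ∣ m → W F h n → W F m n
W-∣ F {h} (divides g ≡.refl) (α , root , sum≈0) = α , (λ i →
    trans (trans (^-congʳ (α i) (ℕ.*-comm g h)) (sym (^-assocʳ (α i) h g))) (trans (^-congˡ g (root i)) (1^ g))) , sum≈0
  where
  open AlgClosureFp F using (semiring; trans; sym; _≈_; 1#; *-identityˡ)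
  open import Algebra.Properties.Semiring.Exp semiring using (^-congˡ; ^-congʳ; ^-assocʳ) renaming (_^_ to _^ᶠ_)
  1^ : ∀ n → (1# ^ᶠ n) ≈ 1#
  1^ zero = AlgClosureFp.refl F
  1^ (suc n) = trans (*-identityˡ _) (1^ n)

module Theorem {c ℓr} {p : ℕ} (F : AlgClosureFp p c ℓr) {m ℓ h d k D : ℕ}
  (p-prime : Prime p) (m≥3 : 3 ≤ m) (p⊥m : gcd p m ≡ 1) (p-1⊥m : gcd (p ∸ 1) m ≡ 1)
  (ℓ≥1 : 1 ≤ ℓ) (ℓ-works : 1 < gcd (p ^ ℓ ∸ 1) m) (ℓ-least : ∀ e → 1 ≤ e → e < ℓ → ¬ (1 < gcd (p ^ e ∸ 1) m))
  (h≡ : h ≡ gcd (p ^ ℓ ∸ 1) m) (dh≡ : d * h ≡ p ^ ℓ ∸ 1) (k≥1 : 1 ≤ k) (Dm≡ : D * m ≡ p ^ k ∸ 1) where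

  private module F = AlgClosureFp F
  open Parameters {p} {m} {ℓ} {h} {d} {k} {D} p-prime m≥3 p⊥m p-1⊥m ℓ≥1 ℓ-works ℓ-least h≡ dh≡ k≥1 Dm≡

  module WithSubfield (sub : Extension.SubfieldAtRoot F p-prime h) where

    open Extension.SubfieldAtRoot sub
    open FieldProperties K
      using (_≟_; _-_; solve; _:=_; _:+_; _:-_; 1^′; pred; *-identityʳ; coprime-orders; module Characteristic)
    open SumsOfRootsOfUnity K using (module Sumsets)

    private
      q = p ^ ℓ

      q≥1 : 1 ≤ q
      q≥1 = ℕ.m^n>0 p {{ℕ.>-nonZero p≥1}} ℓ

      hd≡ : h * d ≡ q ∸ 1
      hd≡ = ≡.trans (ℕ.*-comm h d) dh≡

      ζ^q : ζ ^ᴷ q ≡ ζ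
      ζ^q = ≡.trans (≡.cong (ζ ^ᴷ_) (≡.trans (≡.sym (ℕ.m+[n∸m]≡n q≥1)) (≡.cong suc (≡.sym hd≡))))
        (≡.trans (≡.cong (FieldProperties._*_ K ζ) (1^′ {ζ} h d ζ^h)) (*-identityʳ ζ))

      fermat : ∀ y → y ≢ 0ᴷ → y ^ᴷ (h * d) ≡ 1ᴷ
      fermat y y≢0 = ≡.trans (≡.cong (y ^ᴷ_) hd≡)
        (pred q q≥1 y≢0 (Characteristic.spanned-fixed p-prime char ℓ ζ^q (spanned y)))

      square-roots : ∀ {x} → x ^ᴷ h ≡ 1ᴷ → x ^ᴷ 2 ≡ 1ᴷ → x ≡ 1ᴷ
      square-roots = coprime-orders h⊥2 h≥1

    open Sumsets {p} {h} {d} p-prime char h≥1 d≥1 fermat ζ^h ζ≢1 square-roots spanned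

    sum-in-F : ∀ n {u} → S n u → ∃ λ (α : Fin n → F.Carrier) → (∀ i → α i F.^ h F.≈ F.1#) × (F.sum α F.≈ φ u)
    sum-in-F zero ≡.refl = (λ ()) , (λ ()) , F.sym φ-0
    sum-in-F (suc n) {u} (t , t^h , s) =
      let (α , root , eq) = sum-in-F n s in
      (λ { Fin.zero → φ t ; (Fin.suc i) → α i })
      , (λ { Fin.zero → F.trans (F.sym (φ-^ t h)) (F.trans (F.reflexive (≡.cong φ t^h)) φ-1) ; (Fin.suc i) → root i })
      , F.trans (F.+-congˡ eq) (F.trans (F.sym (φ-+ t (u - t)))
          (F.reflexive (≡.cong φ (solve 2 (λ t u → t :+ (u :- t) := u) ≡.refl t u))))

    S⇒W : ∀ n → S n 0ᴷ → W F h n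
    S⇒W n s = let (α , root , eq) = sum-in-F n s in α , root , F.trans eq φ-0

    p∈S : S p 0ᴷ
    p∈S = ≡.subst (S p) char (S-one p)

    -- Membership in `S d` is decidable, so it is enough to refute its negation, which is the
    -- hypothesis under which the cosets were counted.
    zero-sum-at-d : ¬ (d ≡ p ∸ 1 ⊎ (p ≡ 2 × d ≡ 3 × h ≡ 5)) → S d 0ᴷ
    zero-sum-at-d ordinary = decidable-stable (S? d 0ᴷ) impossible
      where
      d≢p-1 : d ≢ p ∸ 1
      d≢p-1 e = ordinary (inj₁ e)

      impossible : ¬ ¬ S d 0ᴷ
      impossible ¬Sd with ℕ.m≤n⇒m<n∨m≡n p≥2
      ... | inj₂ 2≡p = characteristic-two ¬Sd (≡.sym 2≡p) (4< d d≥1 ≡.refl)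
        where
        p≡2 = ≡.sym 2≡p
        -- `d` divides 2^ℓ - 1 and is odd. The value 1 is case (A) and the value 3 is case (B).
        4< : ∀ n → 1 ≤ n → d ≡ n → 4 < n
        4< 1 _ e = contradiction (≡.trans e (≡.sym (≡.cong (_∸ 1) p≡2))) d≢p-1
        4< 2 _ e = contradiction (divides 1 e) (2∤d p≡2)
        4< 3 _ e = contradiction (inj₂ (p≡2 , e , exceptional p≡2 e)) ordinary
        4< 4 _ e = contradiction (divides 2 e) (2∤d p≡2)
        4< (suc (suc (suc (suc (suc n))))) _ _ = s≤s (s≤s (s≤s (s≤s (s≤s z≤n))))
      ... | inj₁ p≥3 with coprime-inverse h⊥p-1 h≥1
      ...   | b₁ , k₁ , inv₁ with (ζ ^ᴷ 3) ≟ 1ᴷ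
      -- 1 + ζ + ζ² vanishes, and so does the sum of p ones. Their lengths 3 and p generate every
      -- integer from 2 (p - 1) on, `d` among them.
      ...     | yes ζ³≡1 = ¬Sd (let (a , b , e) = three-and-p p≥1 3∤p (2[p-1]≤d d≢p-1) in
                  ≡.subst₂ S (≡.sym e) (FieldProperties.+-identityˡ K 0ᴷ)
                    (S-+ (a * 3) (S-multiple 3 a (cube-root-sum ζ³≡1)) (S-multiple p b p∈S)))
        where
        -- If 3 divided p, then ζ^p = 1 = ζ^h with `h` prime to p, so ζ would be 1.
        3∤p : ¬ 3 ∣ p
        3∤p (divides j e) = ζ≢1 (coprime-orders h⊥p h≥1 ζ^h
          (≡.trans (≡.cong (ζ ^ᴷ_) (≡.trans e (ℕ.*-comm j 3))) (1^′ {ζ} 3 j ζ³≡1)))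
      ...     | no ζ³≢1 with ℕ.m≤n⇒m<n∨m≡n ℓ≥2
      ...       | inj₂ 2≡ℓ = Odd.quadratic ¬Sd p≥3 (2[p-1]≤d d≢p-1) {b₁} {k₁} inv₁ norm ζ³≢1
        where
        norm : ∀ {x} → IsRoot x → x ^ᴷ suc p ≡ 1ᴷ
        norm {x} e with h∣p+1 (≡.sym 2≡ℓ)
        ... | divides j eq = ≡.trans (≡.cong (x ^ᴷ_) (≡.trans eq (ℕ.*-comm j h))) (1^′ {x} h j e)
      ...       | inj₁ ℓ≥3 =
        let (b₂ , k₂ , inv₂) = coprime-inverse (h⊥p²-1 ℓ≥3) h≥1
        in Odd.general ¬Sd p≥3 (2[p-1]≤d d≢p-1) {b₁} {k₁} inv₁ {b₂} {k₂} inv₂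

    all-from-d : ¬ (d ≡ p ∸ 1 ⊎ (p ≡ 2 × d ≡ 3 × h ≡ 5)) → ∀ n → d ≤ n → W F h n
    all-from-d ordinary n d≤n with ℕ.m≤n⇒m<n∨m≡n d≤n
    ... | inj₁ d<n = S⇒W n (zero-sum n d<n)
    ... | inj₂ ≡.refl = S⇒W d (zero-sum-at-d ordinary)

    all-after-d : ∀ n → d + 1 ≤ n → W F h n
    all-after-d n d<n = S⇒W n (zero-sum n (≡.subst (_≤ n) (ℕ.+-comm d 1) d<n))

theorem5p6 : ∀ {c ℓr} (p : ℕ) (F : AlgClosureFp p c ℓr) (m ℓ m′ d′ k d : ℕ) →
    Prime p → 3 ≤ m → gcd p m ≡ 1 → gcd (p ∸ 1) m ≡ 1 →
    1 ≤ ℓ → 1 < gcd (p ^ ℓ ∸ 1) m →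
    (∀ e → 1 ≤ e → e < ℓ → ¬ (1 < gcd (p ^ e ∸ 1) m)) →
    m′ ≡ gcd (p ^ ℓ ∸ 1) m → d′ * m′ ≡ p ^ ℓ ∸ 1 →
    1 ≤ k →
    (∀ α → AlgClosureFp._≈_ F (AlgClosureFp._^_ F α m) (AlgClosureFp.1# F) → InFpk F k α) →
    d * m ≡ p ^ k ∸ 1 →
    (¬ ((d′ ≡ p ∸ 1) ⊎ (p ≡ 2 × d′ ≡ 3 × m′ ≡ 5)) →
    (∀ n → d′ ≤ n → W F m′ n) × (∀ n → d ≤ n → W F m n))
    ×
    (((d′ ≡ p ∸ 1) ⊎ (p ≡ 2 × d′ ≡ 3 × m′ ≡ 5)) →
    (∀ n → d′ + 1 ≤ n → W F m′ n) × (∀ n → d + 1 ≤ n → W F m n))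
theorem5p6 p F m ℓ m′ d′ k d p-prime m≥3 p⊥m p-1⊥m ℓ≥1 ℓ-works ℓ-least m′≡ d′m′≡ k≥1 _ dm≡ =
    (λ ordinary → all-from-d ordinary , λ n d≤n → W-∣ F h∣m (all-from-d ordinary n (ℕ.≤-trans d≤D d≤n)))
  , (λ _ → all-after-d , λ n d<n → W-∣ F h∣m (all-after-d n (ℕ.≤-trans (ℕ.+-monoˡ-≤ 1 d≤D) d<n)))
  where
  open Arithmetic.Parameters {p} {m} {ℓ} {m′} {d′} {k} {d} p-prime m≥3 p⊥m p-1⊥m ℓ≥1 ℓ-works ℓ-least m′≡ d′m′≡ k≥1 dm≡
  open Theorem F {m} {ℓ} {m′} {d′} {k} {d} p-prime m≥3 p⊥m p-1⊥m ℓ≥1 ℓ-works ℓ-least m′≡ d′m′≡ k≥1 dm≡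
  open WithSubfield (Extension.subfieldAtRoot F p-prime {m′} h⊥p h>1)
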